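{- For all expressions $s\in\mathbb{E}_{\mathcal L}$: $s\downarrow_{name}$ if and only if $IT(s)\downarrow_{tree}$, where $IT(s)$ is the infinite tree (letrec-unfolding) of $s$.
   Context: **Syntax.** Fix a set of data constructors partitioned into types; each constructor $c$ has an arity $\mathrm{ar}(c)\ge 0$; the constructors of type $T$ are enumerated as $c_{T,1},\dots,c_{T,|T|}$; there is a type Bool with nullary constructors True, False. Constructors occur only fully saturated. Expressions $\mathbb{E}_{\mathcal L}$: $s,t ::= x \mid (s\ t)\mid (\lambda x.s)\mid (\mathtt{letrec}\ x_1=s_1,\dots,x_n=s_n\ \mathtt{in}\ t)\mid (c\ s_1\dots s_{\mathrm{ar}(c)})\mid(\mathtt{seq}\ s\ t)\mid(\mathtt{case}_T\ s\ \mathtt{of}\ alts)$, where $alts$ has exactly one alternative $((c\ y_1\dots y_{\mathrm{ar}(c)})\to r)$ for each constructor $c$ of type $T$ (the $y_i$ are distinct variables bound in $r$). In letrec, $n\ge1$, the $x_i$ are distinct, the bindings are recursive (the scope of each $x_j$ is $s_1,\dots,s_n,t$) and are identified up to reordering. Expressions are taken up to $\alpha$-equivalence; bound variables are assumed distinct from each other and from free variables, and reductions rename implicitly if necessary. $Env$ denotes a group of letrec-bindings (possibly empty if other bindings are displayed). A value $v$ is an abstraction or a constructor application. **The calculus $L_{name}$** on $\mathbb{E}_{\mathcal L}$: let $L::=[\cdot]\mid\mathtt{letrec}\ Env\ \mathtt{in}\ L$ and $A::=[\cdot]\mid(A\ s)\mid(\mathtt{case}_T\ A\ \mathtt{of}\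 alts)\mid(\mathtt{seq}\ A\ s)$; reduction contexts are $R=L[A]$. $\xrightarrow{name}$ is given by: (beta) $R[(\lambda x.s)\ t]\to R[s[t/x]]$; (gcp) $L[\mathtt{letrec}\ Env,x=s\ \mathtt{in}\ R[x]]\to L[\mathtt{letrec}\ Env,x=s\ \mathtt{in}\ R[s]]$ (with $x$ the displayed bound variable); (lapp) $R[((\mathtt{letrec}\ Env\ \mathtt{in}\ s)\ t)]\to R[\mathtt{letrec}\ Env\ \mathtt{in}\ (s\ t)]$; (lcase) $R[\mathtt{case}_T\ (\mathtt{letrec}\ Env\ \mathtt{in}\ s)\ \mathtt{of}\ alts]\to R[\mathtt{letrec}\ Env\ \mathtt{in}\ (\mathtt{case}_T\ s\ \mathtt{of}\ alts)]$; (lseq) $R[\mathtt{seq}\ (\mathtt{letrec}\ Env\ \mathtt{in}\ s)\ t]\to R[\mathtt{letrec}\ Env\ \mathtt{in}\ (\mathtt{seq}\ s\ t)]$; (seq) $R[\mathtt{seq}\ v\ s]\to R[s]$ for a value $v$; (case) $R[\mathtt{case}_T\ (c\ s_1\dots s_k)\ \mathtt{of}\dots((c\ x_1\dots x_k)\to t)\dots]\to R[t[s_1/x_1,\dots,s_k/x_k]]$. The $L_{name}$-WHNFs (answers) are the expressions $L[v]$ with $v$ a value. $s\downarrow_{name}$ means $s\xrightarrow{name,*}w$ for some WHNF $w$. **Infinite trees.** Infinite expressions are given by the co-inductively interpreted grammar $S::=x\mid(S_1\ S_2)\mid(\lambda x.S)\mid\mathtt{Bot}\mid(c\ S_1\dots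 S_{\mathrm{ar}(c)})\mid(\mathtt{seq}\ S_1\ S_2)\mid(\mathtt{case}_T\ S\ \mathtt{of}\ alts)$, up to $\alpha$-equality; $\mathtt{Bot}$ is a constant. They are represented as partial functions from positions (finite sequences of positive integers, $\varepsilon$ empty) to labels $@$ (application), $\mathtt{case}_T$, $(c\ x_1\dots x_n)$ (the root of a case-alternative), $\mathtt{seq}$, $c$, $\lambda x$, $x$, $\mathtt{Bot}$. For $s\in\mathbb{E}_{\mathcal L}$, the tree $IT(s)$ is defined by computing its label at position $p$: start with $s\|_p$ (a marker with position $p$ at the root of $s$) and proceed within $s$ as follows. - $(\lambda x.s)\|_{1.p}$ moves to $s\|_p$; $(s\ t)\|_{1.p}$ to $s\|_p$ and $(s\ t)\|_{2.p}$ to $t\|_p$; likewise for $(\mathtt{seq}\ s\ t)$; $(c\ s_1\dots s_n)\|_{i.p}$ to $s_i\|_p$; $(\mathtt{case}_T\ s\ \mathtt{of}\ alt_1\dots alt_n)\|_{1.p}$ to $s\|_p$ and $\|_{(i+1).p}$ to $alt_i\|_p$; an alternative $((c\ x_1\dots x_n)\to s)\|_{1.p}$ to $s\|_p$; - for every $p$ (including $\varepsilon$): $(\mathtt{letrec}\ Env\ \mathtt{in}\ s)\|_p$ moves to $s\|_p$, and a letrec-bound variable occurrence $x\|_p$ moves to $s\|_p$, where $x=s$ is the binding of $x$. - With position $\varepsilon$ at any other node, return its label: $@$ for an application, $\mathtt{case}_T$, $(c\ x_1\dots x_n)$ for an alternative, $\mathtt{seq}$, $c$ for a constructor application, $\lambda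 x$ for an abstraction, and $x$ for a variable that is free, lambda-bound or pattern-bound. - If with position $\varepsilon$ the same letrec-bound variable is hit twice, the result is $\mathtt{Bot}$. If the computation fails or is undefined, the position is not in the tree. **Tree reduction.** Reduction contexts (inductive): $R::=[\cdot]\mid(R\ S)\mid(\mathtt{case}_T\ R\ \mathtt{of}\ alts)\mid(\mathtt{seq}\ R\ S)$. Answers: abstractions and constructor applications. $R[S_1]\xrightarrow{tree}R[S_2]$ if $S_1\to S_2$ by one of: $((\lambda x.S_1)\ S_2)\to S_1[S_2/x]$; $(\mathtt{seq}\ S_1\ S_2)\to S_2$ if $S_1$ is an answer; $(\mathtt{case}_T\ (c\ S_1\dots S_n)\ \mathtt{of}\dots((c\ x_1\dots x_n)\to S')\dots)\to S'[S_1/x_1,\dots,S_n/x_n]$. $S\downarrow_{tree}$ means $S\xrightarrow{tree,*}S'$ for some answer $S'$ (finitely many steps). -}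

module Defs where

open import Data.Bool.Base using (Bool; true; false; if_then_else_)
open import Data.Fin.Base using (Fin; zero; suc; toℕ; _↑ˡ_; _↑ʳ_; splitAt)
open import Data.List.Base using (List; []; _∷_)
open import Data.Maybe.Base using (Maybe; just; nothing; maybe′)
open import Data.Nat.Base using (ℕ; zero; suc; _+_; _∸_; _≤_; z≤n; s≤s; NonZero)
open import Data.Product.Base using (Σ; ∃; _×_; _,_; proj₁; proj₂)
open import Data.Sum.Base using ([_,_])
open import Data.Unit.Base using (⊤; tt)
open import Data.Vec.Base using (Vec; replicate; lookup; _[_]≔_)
open import Function.Base using (_∘_; const)
open import Relation.Binary.Construct.Closure.ReflexiveTransitive using (Star)
open import Relation.Binary.PropositionalEquality using (_≡_; refl)

-- The constructors of type T are the elements of Fin ∣ T ∣.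
record Signature : Set₁ where
  field
    Type      : Set
    ∣_∣       : Type → ℕ
    nonEmpty  : ∀ T → NonZero ∣ T ∣
    ar        : (T : Type) → Fin ∣ T ∣ → ℕ
    BoolType  : Type
    ∣Bool∣    : ∣ BoolType ∣ ≡ 2
    ar-Bool   : ∀ c → ar BoolType c ≡ 0

module Calculus (𝒮 : Signature) where
  open Signature 𝒮

  -- Well-scoped de Bruijn terms, so that α-equivalent expressions are
  -- identified.  A binder for k variables turns scope n into k + n, the
  -- new variables being i ↑ˡ n and the old ones k ↑ʳ x.  Bindings of a
  -- letrec are listed in some order, but no definition below depends on
  -- that order.
  data Expr (n : ℕ) : Set where
    var    : Fin n → Expr n
    app    : Expr n → Expr n → Expr n
    lam    : Expr (1 + n) → Expr n
    letrec : ∀ {k} → (Fin (suc k) → Expr (suc k + n)) → Expr (suc k + n) → Expr n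
    con    : (T : Type) (c : Fin ∣ T ∣) → (Fin (ar T c) → Expr n) → Expr n
    seq    : Expr n → Expr n → Expr n
    case   : (T : Type) → Expr n → ((c : Fin ∣ T ∣) → Expr (ar T c + n)) → Expr n

  data Value {n} : Expr n → Set where
    lam : ∀ {s} → Value (lam s)
    con : ∀ {T c ss} → Value (con T c ss)

  liftRen : ∀ k {m n} → (Fin m → Fin n) → Fin (k + m) → Fin (k + n)
  liftRen k {n = n} ρ x = [ _↑ˡ n , (k ↑ʳ_) ∘ ρ ] (splitAt k x)

  rename : ∀ {m n} → (Fin m → Fin n) → Expr m → Expr n
  rename ρ (var x)              = var (ρ x)
  rename ρ (app s t)            = app (rename ρ s) (rename ρ t)
  rename ρ (lam s)              = lam (rename (liftRen 1 ρ) s)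
  rename ρ (letrec {k} bs t)    =
    letrec (λ i → rename (liftRen (suc k) ρ) (bs i)) (rename (liftRen (suc k) ρ) t)
  rename ρ (con T c ss)         = con T c (λ i → rename ρ (ss i))
  rename ρ (seq s t)            = seq (rename ρ s) (rename ρ t)
  rename ρ (case T s alts)      =
    case T (rename ρ s) (λ c → rename (liftRen (ar T c) ρ) (alts c))

  weaken : ∀ k {n} → Expr n → Expr (k + n)
  weaken k = rename (k ↑ʳ_)

  liftSub : ∀ k {m n} → (Fin m → Expr n) → Fin (k + m) → Expr (k + n)
  liftSub k {n = n} σ x = [ var ∘ (_↑ˡ n) , weaken k ∘ σ ] (splitAt k x)

  subst : ∀ {m n} → (Fin m → Expr n) → Expr m → Expr n
  subst σ (var x)           = σ x
  subst σ (app s t)         = app (subst σ s) (subst σ t)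
  subst σ (lam s)           = lam (subst (liftSub 1 σ) s)
  subst σ (letrec {k} bs t) =
    letrec (λ i → subst (liftSub (suc k) σ) (bs i)) (subst (liftSub (suc k) σ) t)
  subst σ (con T c ss)      = con T c (λ i → subst σ (ss i))
  subst σ (seq s t)         = seq (subst σ s) (subst σ t)
  subst σ (case T s alts)   =
    case T (subst σ s) (λ c → subst (liftSub (ar T c) σ) (alts c))

  -- s ⟨ ts ⟩ is s [ t₁ / x₁ , … , tₖ / xₖ ].
  _⟨_⟩ : ∀ {k n} → Expr (k + n) → (Fin k → Expr n) → Expr n
  _⟨_⟩ {k} s ts = subst ([ ts , var ] ∘ splitAt k) s

  -- In LCtx n m the context lives in scope n and its hole in scope m.
  data LCtx (n : ℕ) : ℕ → Set where
    □      : LCtx n n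
    letrec : ∀ {k m} → (Fin (suc k) → Expr (suc k + n)) → LCtx (suc k + n) m → LCtx n m

  data ACtx (n : ℕ) : Set where
    □    : ACtx n
    app  : ACtx n → Expr n → ACtx n
    case : (T : Type) → ACtx n → ((c : Fin ∣ T ∣) → Expr (ar T c + n)) → ACtx n
    seq  : ACtx n → Expr n → ACtx n

  infix 30 _L[_] _A[_] _R[_] _T[_]

  _L[_] : ∀ {n m} → LCtx n m → Expr m → Expr n
  □           L[ s ] = s
  letrec bs L L[ s ] = letrec bs (L L[ s ])

  _A[_] : ∀ {n} → ACtx n → Expr n → Expr n
  □             A[ s ] = s
  app A t       A[ s ] = app (A A[ s ]) t
  case T A alts A[ s ] = case T (A A[ s ]) alts
  seq A t       A[ s ] = seq (A A[ s ]) t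

  RCtx : ℕ → ℕ → Set
  RCtx n m = LCtx n m × ACtx m

  _R[_] : ∀ {n m} → RCtx n m → Expr m → Expr n
  (L , A) R[ s ] = L L[ A A[ s ] ]

  -- Moves variables from outside an L-context to its hole.
  inL : ∀ {n m} → LCtx n m → Fin n → Fin m
  inL □                x = x
  inL (letrec {k} _ L) x = inL L (suc k ↑ʳ x)

  infix 4 _⟶name_ _⟶name*_

  data _⟶name_ {n : ℕ} : Expr n → Expr n → Set where
    beta  : ∀ {m} (R : RCtx n m) {s t} →
            R R[ app (lam s) t ] ⟶name R R[ s ⟨ const t ⟩ ]
    gcp   : ∀ {m k p} (L : LCtx n m) (bs : Fin (suc k) → Expr (suc k + m))
            (L′ : LCtx (suc k + m) p) (A : ACtx p) (i : Fin (suc k)) →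
            L L[ letrec bs ((L′ , A) R[ var (inL L′ (i ↑ˡ m)) ]) ]
              ⟶name
            L L[ letrec bs ((L′ , A) R[ rename (inL L′) (bs i) ]) ]
    lapp  : ∀ {m k} (R : RCtx n m) {bs : Fin (suc k) → Expr (suc k + m)} {s t} →
            R R[ app (letrec bs s) t ]
              ⟶name
            R R[ letrec bs (app s (weaken (suc k) t)) ]
    lcase : ∀ {m k} (R : RCtx n m) {bs : Fin (suc k) → Expr (suc k + m)} {s T}
            {alts : (c : Fin ∣ T ∣) → Expr (ar T c + m)} →
            R R[ case T (letrec bs s) alts ]
              ⟶name
            R R[ letrec bs (case T s λ c → rename (liftRen (ar T c) (suc k ↑ʳ_)) (alts c)) ]
    lseq  : ∀ {m k} (R : RCtx n m) {bs : Fin (suc k) → Expr (suc k + m)} {s t} →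
            R R[ seq (letrec bs s) t ]
              ⟶name
            R R[ letrec bs (seq s (weaken (suc k) t)) ]
    seq   : ∀ {m} (R : RCtx n m) {v s} → Value v →
            R R[ seq v s ] ⟶name R R[ s ]
    case  : ∀ {m} (R : RCtx n m) {T c ss}
            {alts : (c : Fin ∣ T ∣) → Expr (ar T c + m)} →
            R R[ case T (con T c ss) alts ] ⟶name R R[ alts c ⟨ ss ⟩ ]

  _⟶name*_ : ∀ {n} → Expr n → Expr n → Set
  _⟶name*_ = Star _⟶name_

  data WHNF {n : ℕ} : Expr n → Set where
    whnf : ∀ {m} (L : LCtx n m) {v} → Value v → WHNF (L L[ v ])

  infix 4 _↓name _↓tree

  _↓name : ∀ {n} → Expr n → Set
  s ↓name = ∃ λ w → s ⟶name* w × WHNF w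

  -- Binders are nameless: lam stands for λx and alt T c for the root
  -- (c x₁ … xₙ) of a case-alternative.  A variable is a de Bruijn index
  -- counting the binders on the path from the root to its position;
  -- indices beyond those denote free variables.
  data Label : Set where
    var  : ℕ → Label
    app  : Label
    lam  : Label
    bot  : Label
    con  : (T : Type) (c : Fin ∣ T ∣) → Label
    seq  : Label
    case : (T : Type) → Label
    alt  : (T : Type) (c : Fin ∣ T ∣) → Label

  rank : Label → ℕ
  rank (var x)   = 0
  rank app       = 2
  rank lam       = 1
  rank bot       = 0
  rank (con T c) = ar T c
  rank seq       = 2
  rank (case T)  = 1 + ∣ T ∣
  rank (alt T c) = 1

  binders : Label → ℕ
  binders lam       = 1
  binders (alt T c) = ar T c
  binders _         = 0

  -- Subtrees are numbered from 0.
  Position : Set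
  Position = List ℕ

  Labelling : Set
  Labelling = Position → Maybe Label

  empty : Labelling
  empty _ = nothing

  infixl 8 _/_
  _/_ : Labelling → ℕ → Labelling
  (S / i) p = S (i ∷ p)

  -- The number i as an element of Fin k, if i < k.
  select : ∀ k → ℕ → Maybe (Fin k)
  select zero    _       = nothing
  select (suc k) zero    = just zero
  select (suc k) (suc i) = maybe′ (just ∘ suc) nothing (select k i)

  data Sort : Set where
    expr : Sort
    alt  : (T : Type) (c : Fin ∣ T ∣) → Sort

  sort : Label → Sort
  sort (alt T c) = alt T c
  sort _         = expr

  childSort : ∀ ℓ → Fin (rank ℓ) → Sort
  childSort (case T) (suc c) = alt T c
  childSort _        _       = expr

  -- The grammar of infinite expressions, checked down to depth d.  Its
  -- co-inductive interpretation is conformance to every depth.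
  Conforms : (d : ℕ) → Sort → Labelling → Set
  Conforms zero    κ S = ⊤
  Conforms (suc d) κ S = ∃ λ ℓ → S [] ≡ just ℓ × sort ℓ ≡ κ
    × (∀ (j : Fin (rank ℓ)) → Conforms d (childSort ℓ j) (S / toℕ j))
    × (∀ i → rank ℓ ≤ i → ∀ p → (S / i) p ≡ nothing)

  record InfExpr : Set where
    field
      label    : Labelling
      conforms : ∀ d → Conforms d expr label
  open InfExpr public

  -- Binders being nameless, this is equality up to α.
  infix 4 _≈_
  _≈_ : InfExpr → InfExpr → Set
  S ≈ T = ∀ p → label S p ≡ label T p

  node : (ℓ : Label) → (Fin (rank ℓ) → Labelling) → Labelling
  node ℓ Ss []      = just ℓ
  node ℓ Ss (i ∷ p) = maybe′ Ss empty (select (rank ℓ) i) p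

  select-toℕ : ∀ {k} (j : Fin k) → select k (toℕ j) ≡ just j
  select-toℕ zero    = refl
  select-toℕ (suc j) rewrite select-toℕ j = refl

  select-≥ : ∀ {k i} → k ≤ i → select k i ≡ nothing
  select-≥ z≤n                               = refl
  select-≥ (s≤s k≤i) rewrite select-≥ k≤i = refl

  node-conforms : ∀ ℓ {Ss} → (∀ d j → Conforms d (childSort ℓ j) (Ss j)) →
                  ∀ d → Conforms d (sort ℓ) (node ℓ Ss)
  node-conforms ℓ {Ss} ok zero    = tt
  node-conforms ℓ {Ss} ok (suc d) = ℓ , refl , refl , children , outside
    where
    children : ∀ j → Conforms d (childSort ℓ j) (node ℓ Ss / toℕ j)
    children j rewrite select-toℕ j = ok d j
    outside : ∀ i → rank ℓ ≤ i → ∀ p → (node ℓ Ss / i) p ≡ nothing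
    outside i r≤i p rewrite select-≥ r≤i = refl

  pair : {A : Set} → A → A → Fin 2 → A
  pair a b zero    = a
  pair a b (suc _) = b

  varᵗ : ℕ → InfExpr
  label    (varᵗ x) = node (var x) λ ()
  conforms (varᵗ x) = node-conforms (var x) λ _ ()

  appᵗ : InfExpr → InfExpr → InfExpr
  label    (appᵗ S T) = node app (pair (label S) (label T))
  conforms (appᵗ S T) = node-conforms app
    λ { d zero → conforms S d ; d (suc _) → conforms T d }

  lamᵗ : InfExpr → InfExpr
  label    (lamᵗ S) = node lam (const (label S))
  conforms (lamᵗ S) = node-conforms lam λ d _ → conforms S d

  conᵗ : (T : Type) (c : Fin ∣ T ∣) → (Fin (ar T c) → InfExpr) → InfExpr
  label    (conᵗ T c Ss) = node (con T c) (label ∘ Ss)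
  conforms (conᵗ T c Ss) = node-conforms (con T c) λ d j → conforms (Ss j) d

  seqᵗ : InfExpr → InfExpr → InfExpr
  label    (seqᵗ S T) = node seq (pair (label S) (label T))
  conforms (seqᵗ S T) = node-conforms seq
    λ { d zero → conforms S d ; d (suc _) → conforms T d }

  caseChildren : (T : Type) → InfExpr → (Fin ∣ T ∣ → InfExpr) → Fin (1 + ∣ T ∣) → Labelling
  caseChildren T S alts zero    = label S
  caseChildren T S alts (suc c) = node (alt T c) (const (label (alts c)))

  caseᵗ : (T : Type) → InfExpr → (Fin ∣ T ∣ → InfExpr) → InfExpr
  label    (caseᵗ T S alts) = node (case T) (caseChildren T S alts)
  conforms (caseᵗ T S alts) = node-conforms (case T)
    λ { d zero    → conforms S d
      ; d (suc c) → node-conforms (alt T c) (λ e _ → conforms (alts c) e) d }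

  extRen : (ℕ → ℕ) → ℕ → ℕ
  extRen ρ zero    = zero
  extRen ρ (suc x) = suc (ρ x)

  liftRenᵗ : ℕ → (ℕ → ℕ) → ℕ → ℕ
  liftRenᵗ zero    ρ = ρ
  liftRenᵗ (suc k) ρ = extRen (liftRenᵗ k ρ)

  renLabel : (ℕ → ℕ) → Label → Label
  renLabel ρ (var x) = var (ρ x)
  renLabel ρ ℓ       = ℓ

  -- The first argument is the root label of the labelling.
  renAt : Maybe Label → (ℕ → ℕ) → Labelling → Labelling
  renAt nothing  ρ S p       = nothing
  renAt (just ℓ) ρ S []      = just (renLabel ρ ℓ)
  renAt (just ℓ) ρ S (i ∷ p) =
    renAt (S (i ∷ [])) (liftRenᵗ (binders ℓ) ρ) (S / i) p

  renLabelling : (ℕ → ℕ) → Labelling → Labelling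
  renLabelling ρ S = renAt (S []) ρ S

  outside-ren : ∀ ρ S → (∀ p → S p ≡ nothing) → ∀ p → renLabelling ρ S p ≡ nothing
  outside-ren ρ S none p rewrite none [] = refl

  ren-conforms : ∀ d {κ} ρ S → Conforms d κ S → Conforms d κ (renLabelling ρ S)
  ren-conforms zero    ρ S _ = tt
  ren-conforms (suc d) ρ S (ℓ , eq , refl , ok , none) rewrite eq = go ℓ ok none
    where
    go : ∀ ℓ → (∀ j → Conforms d (childSort ℓ j) (S / toℕ j)) →
         (∀ i → rank ℓ ≤ i → ∀ p → (S / i) p ≡ nothing) →
         Conforms (suc d) (sort ℓ) (renAt (just ℓ) ρ S)
    go (var x)   ok none = var (ρ x) , refl , refl , (λ ()) ,
      λ i r → outside-ren _ (S / i) (none i r)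
    go app       ok none = app , refl , refl ,
      (λ j → ren-conforms d _ _ (ok j)) , λ i r → outside-ren _ (S / i) (none i r)
    go lam       ok none = lam , refl , refl ,
      (λ j → ren-conforms d _ _ (ok j)) , λ i r → outside-ren _ (S / i) (none i r)
    go bot       ok none = bot , refl , refl ,
      (λ ()) , λ i r → outside-ren _ (S / i) (none i r)
    go (con T c) ok none = con T c , refl , refl ,
      (λ j → ren-conforms d _ _ (ok j)) , λ i r → outside-ren _ (S / i) (none i r)
    go seq       ok none = seq , refl , refl ,
      (λ j → ren-conforms d _ _ (ok j)) , λ i r → outside-ren _ (S / i) (none i r)
    go (case T)  ok none = case T , refl , refl ,
      (λ j → ren-conforms d _ _ (ok j)) , λ i r → outside-ren _ (S / i) (none i r)
    go (alt T c) ok none = alt T c , refl , refl ,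
      (λ j → ren-conforms d _ _ (ok j)) , λ i r → outside-ren _ (S / i) (none i r)

  renᵗ : (ℕ → ℕ) → InfExpr → InfExpr
  label    (renᵗ ρ S)   = renLabelling ρ (label S)
  conforms (renᵗ ρ S) d = ren-conforms d ρ (label S) (conforms S d)

  extSub : (ℕ → InfExpr) → ℕ → InfExpr
  extSub σ zero    = varᵗ zero
  extSub σ (suc x) = renᵗ suc (σ x)

  liftSubᵗ : ℕ → (ℕ → InfExpr) → ℕ → InfExpr
  liftSubᵗ zero    σ = σ
  liftSubᵗ (suc k) σ = extSub (liftSubᵗ k σ)

  -- The first argument is the root label of the labelling.
  subAt : Maybe Label → (ℕ → InfExpr) → Labelling → Labelling
  subAt nothing        σ S p       = nothing
  subAt (just (var x)) σ S p       = label (σ x) p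
  subAt (just ℓ)       σ S []      = just ℓ
  subAt (just ℓ)       σ S (i ∷ p) =
    subAt (S (i ∷ [])) (liftSubᵗ (binders ℓ) σ) (S / i) p

  subLabelling : (ℕ → InfExpr) → Labelling → Labelling
  subLabelling σ S = subAt (S []) σ S

  outside-sub : ∀ σ S → (∀ p → S p ≡ nothing) → ∀ p → subLabelling σ S p ≡ nothing
  outside-sub σ S none p rewrite none [] = refl

  sub-conforms : ∀ d {κ} σ S → Conforms d κ S → Conforms d κ (subLabelling σ S)
  sub-conforms zero    σ S _ = tt
  sub-conforms (suc d) σ S (ℓ , eq , refl , ok , none) rewrite eq = go ℓ ok none
    where
    go : ∀ ℓ → (∀ j → Conforms d (childSort ℓ j) (S / toℕ j)) →
         (∀ i → rank ℓ ≤ i → ∀ p → (S / i) p ≡ nothing) →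
         Conforms (suc d) (sort ℓ) (subAt (just ℓ) σ S)
    go (var x)   ok none = conforms (σ x) (suc d)
    go app       ok none = app , refl , refl ,
      (λ j → sub-conforms d _ _ (ok j)) , λ i r → outside-sub _ (S / i) (none i r)
    go lam       ok none = lam , refl , refl ,
      (λ j → sub-conforms d _ _ (ok j)) , λ i r → outside-sub _ (S / i) (none i r)
    go bot       ok none = bot , refl , refl ,
      (λ ()) , λ i r → outside-sub _ (S / i) (none i r)
    go (con T c) ok none = con T c , refl , refl ,
      (λ j → sub-conforms d _ _ (ok j)) , λ i r → outside-sub _ (S / i) (none i r)
    go seq       ok none = seq , refl , refl ,
      (λ j → sub-conforms d _ _ (ok j)) , λ i r → outside-sub _ (S / i) (none i r)
    go (case T)  ok none = case T , refl , refl ,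
      (λ j → sub-conforms d _ _ (ok j)) , λ i r → outside-sub _ (S / i) (none i r)
    go (alt T c) ok none = alt T c , refl , refl ,
      (λ j → sub-conforms d _ _ (ok j)) , λ i r → outside-sub _ (S / i) (none i r)

  subᵗ : (ℕ → InfExpr) → InfExpr → InfExpr
  label    (subᵗ σ S)   = subLabelling σ (label S)
  conforms (subᵗ σ S) d = sub-conforms d σ (label S) (conforms S d)

  -- S ⟨ k ∣ Ss ⟩ᵗ is S [ S₁ / x₁ , … , Sₖ / xₖ ] for the k innermost
  -- variables of S; the remaining indices drop by k.
  _⟨_∣_⟩ᵗ : InfExpr → ∀ k → (Fin k → InfExpr) → InfExpr
  S ⟨ k ∣ Ss ⟩ᵗ = subᵗ (λ x → maybe′ Ss (varᵗ (x ∸ k)) (select k x)) S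

  data TreeCtx : Set where
    □    : TreeCtx
    app  : TreeCtx → InfExpr → TreeCtx
    case : (T : Type) → TreeCtx → (Fin ∣ T ∣ → InfExpr) → TreeCtx
    seq  : TreeCtx → InfExpr → TreeCtx

  _T[_] : TreeCtx → InfExpr → InfExpr
  □             T[ S ] = S
  app R S′      T[ S ] = appᵗ (R T[ S ]) S′
  case T R alts T[ S ] = caseᵗ T (R T[ S ]) alts
  seq R S′      T[ S ] = seqᵗ (R T[ S ]) S′

  data Answer (S : InfExpr) : Set where
    lam : ∀ {S′} → S ≈ lamᵗ S′ → Answer S
    con : ∀ {T c Ss} → S ≈ conᵗ T c Ss → Answer S

  infix 4 _↦_ _⟶tree_ _⟶tree*_

  data _↦_ : InfExpr → InfExpr → Set where
    beta : ∀ {S₁ S₂} → appᵗ (lamᵗ S₁) S₂ ↦ S₁ ⟨ 1 ∣ const S₂ ⟩ᵗ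
    seq  : ∀ {S₁ S₂} → Answer S₁ → seqᵗ S₁ S₂ ↦ S₂
    case : ∀ {T c Ss alts} →
           caseᵗ T (conᵗ T c Ss) alts ↦ alts c ⟨ ar T c ∣ Ss ⟩ᵗ

  data _⟶tree_ (S S′ : InfExpr) : Set where
    step : ∀ (R : TreeCtx) {S₁ S₂} →
           S ≈ R T[ S₁ ] → S₁ ↦ S₂ → S′ ≈ R T[ S₂ ] → S ⟶tree S′

  _⟶tree*_ : InfExpr → InfExpr → Set
  _⟶tree*_ = Star _⟶tree_

  _↓tree : InfExpr → Set
  S ↓tree = ∃ λ S′ → S ⟶tree* S′ × Answer S′

  -- What the variables in scope at a marker are: `free d` and `bound d`
  -- declare variables that occur in the tree, with index d + x for the
  -- x-th of them (`bound` is a λ- or pattern-binder); `rec` declares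
  -- letrec-bound variables together with their bindings.
  data Env : ℕ → Set where
    free  : ∀ {n} → ℕ → Env n
    bound : ∀ {k n} → ℕ → Env n → Env (k + n)
    rec   : ∀ {k n} → (Fin (suc k) → Expr (suc k + n)) → Env n → Env (suc k + n)

  shift : ∀ {n} → ℕ → Env n → Env n
  shift k (free d)    = free (k + d)
  shift k (bound d η) = bound (k + d) (shift k η)
  shift k (rec bs η)  = rec bs (shift k η)

  under : ∀ k {n} → Env n → Env (k + n)
  under k η = bound 0 (shift k η)

  data Marker : Sort → Set where
    expr : ∀ {n} → Env n → Expr n → Marker expr
    alt  : ∀ {n} T c → Env n → Expr (ar T c + n) → Marker (alt T c)

  -- The label of the node at which a marker with position ε stops, and
  -- where a marker with position i.p at that node moves to, for each i.
  Stop : Sort → Set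
  Stop κ = Σ Label λ ℓ → sort ℓ ≡ κ × ((j : Fin (rank ℓ)) → Marker (childSort ℓ j))

  -- `walk` moves a marker from a letrec to its body and from a
  -- letrec-bound variable to its binding until it stops at some other
  -- node, or at Bot if a letrec-bound variable is hit twice.  The second
  -- argument is the outcome of hitting each of the variables in scope.
  --
  -- In `enter`, V records which variables of the group bs were already
  -- hit, and the number u counts those that were not, so that the first
  -- clause only applies when all of them are in V.  Marks of a group are
  -- dropped when the marker leaves its scope by hitting a variable bound
  -- further out.  This does not affect the outcome: the moves are
  -- determined by the place in the text, so a walk that hits a variable
  -- again is on a cycle, and the variables of outermost scope on that
  -- cycle keep their marks.
  walk  : ∀ {n} → Env n → (Fin n → Stop expr) → Expr n → Stop expr
  enter : ∀ {k n} → (Fin (suc k) → Expr (suc k + n)) → Env n → (Fin n → Stop expr) →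
          (u : ℕ) (V : Vec Bool (suc k)) → Fin (suc k) → Stop expr

  walk η hit (var x)           = hit x
  walk η hit (app s t)         = app , refl , pair (expr η s) (expr η t)
  walk η hit (lam s)           = lam , refl , const (expr (under 1 η) s)
  walk η hit (letrec {k} bs t) =
    walk (rec bs η)
         ([ enter bs η hit (suc k) (replicate (suc k) false) , hit ] ∘ splitAt (suc k)) t
  walk η hit (con T c ss)      = con T c , refl , λ i → expr η (ss i)
  walk η hit (seq s t)         = seq , refl , pair (expr η s) (expr η t)
  walk η hit (case T s alts)   =
    case T , refl , λ { zero → expr η s ; (suc c) → alt T c η (alts c) }

  enter     bs η hit zero    V i = bot , refl , λ ()
  enter {k} bs η hit (suc u) V i =
    if lookup V i then (bot , refl , λ ()) else
    walk (rec bs η)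
         ([ enter bs η hit u (V [ i ]≔ true) , hit ] ∘ splitAt (suc k)) (bs i)

  -- The outcome of hitting a variable when none has been hit before.
  hit₀ : ∀ {n} → Env n → Fin n → Stop expr
  hit₀ (free d)        x = var (d + toℕ x) , refl , λ ()
  hit₀ (bound {k} d η) x =
    [ (λ i → var (d + toℕ i) , refl , λ ()) , hit₀ η ] (splitAt k x)
  hit₀ (rec {k} bs η)  x =
    [ enter bs η (hit₀ η) (suc k) (replicate (suc k) false) , hit₀ η ] (splitAt (suc k) x)

  stop : ∀ {κ} → Marker κ → Stop κ
  stop (expr η s)    = walk η (hit₀ η) s
  stop (alt T c η s) = alt T c , refl , const (expr (under (ar T c) η) s)

  labelAt : ∀ {κ} → Marker κ → Labelling
  labelAt μ []      = just (proj₁ (stop μ))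
  labelAt μ (i ∷ p) with stop μ
  ... | ℓ , _ , μs = maybe′ (λ j → labelAt (μs j) p) nothing (select (rank ℓ) i)

  labelAt-conforms : ∀ d {κ} (μ : Marker κ) → Conforms d κ (labelAt μ)
  labelAt-conforms zero    μ = tt
  labelAt-conforms (suc d) {κ} μ =
    ℓ , refl , proj₁ (proj₂ (stop μ)) , children , outside
    where
    ℓ = proj₁ (stop μ)
    children : ∀ j → Conforms d (childSort ℓ j) (labelAt μ / toℕ j)
    children j rewrite select-toℕ {rank ℓ} j =
      labelAt-conforms d (proj₂ (proj₂ (stop μ)) j)
    outside : ∀ i → rank ℓ ≤ i → ∀ p → (labelAt μ / i) p ≡ nothing
    outside i r≤i p rewrite select-≥ r≤i = refl

  unfold : ∀ {n} → Env n → Expr n → InfExpr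
  label    (unfold η s)   = labelAt (expr η s)
  conforms (unfold η s) d = labelAt-conforms d (expr η s)

  IT : ∀ {n} → Expr n → InfExpr
  IT s = unfold (free 0) s

{-# OPTIONS --safe #-}

-- Rather than computing with IT, both directions go through a relation
-- γ ⊢ s ∼ S: whenever s, walked through its letrecs under the environment γ,
-- stops at a node, S has that node at its root with related subtrees, and if
-- the walk never stops, the root of S is Bot.  IT(s) is related to s, the
-- relation is preserved by renaming and substitution, and all name-steps other
-- than beta, case and seq leave the tree unchanged, so name reduction is
-- mirrored in the tree.  Conversely, if the root of S is an inner node other
-- than Bot, the walk from s to its node is finite, and its moves are performed
-- by gcp, lapp, lcase and lseq; this exposes in s whatever redex S has.

module Submission where

open import Data.Bool.Base using (Bool; true; false)
open import Data.Empty using (⊥; ⊥-elim)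
open import Data.Fin.Base using (Fin; zero; suc; toℕ; fromℕ<; _↑ˡ_; _↑ʳ_; splitAt)
open import Data.Fin.Properties
  using (toℕ-fromℕ<; splitAt-↑ˡ; splitAt-↑ʳ; splitAt⁻¹-↑ˡ; splitAt⁻¹-↑ʳ; _≟_)
open import Data.List.Base using ([]; _∷_; length)
open import Data.Maybe.Base using (Maybe; just; nothing; maybe′)
open import Data.Maybe.Properties using (just-injective)
open import Data.Maybe.Relation.Binary.Pointwise using (Pointwise; just; nothing)
open import Data.Nat.Base using (ℕ; zero; suc; _+_; _∸_; _≤_; z≤n; s≤s; s≤s⁻¹)
open import Data.Nat.Properties
  using (≤-total; ≤-trans; ≤-reflexive; n≤1+n; +-assoc; _<?_; ≮⇒≥; m≤m+n; m+n∸m≡n)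
open import Data.Product.Base using (∃; _×_; _,_; proj₁; proj₂)
open import Data.Sum.Base using (_⊎_; inj₁; inj₂; [_,_])
open import Data.Vec.Base using (Vec; []; _∷_; lookup; replicate; _[_]≔_)
open import Data.Vec.Properties using (lookup-replicate; lookup∘update′)
open import Data.Unit.Base using (⊤; tt)
open import Function.Base using (_∘_; const; case_of_)
open import Function.Bundles using (_⇔_; mk⇔)
open import Relation.Binary.Construct.Closure.ReflexiveTransitive using (ε; _◅_; _◅◅_)
open import Relation.Nullary using (yes; no)
open import Relation.Binary.PropositionalEquality as ≡
  using (_≡_; _≢_; refl; sym; trans; cong)
open import Defs

-- The marks that `walk` keeps of the variables already hit fit badly with reduction, since
-- substitution and copying change the bindings. `run` therefore forgets them and counts fuel, which
-- is monotone and deterministic; marks and fuel meet only in the proof that `IT(s)` is related to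
-- `s`. Whether a walk stops for some fuel cannot be decided by inspecting all fuels, so `Sim`
-- carries the evidence, and the computable `walk` supplies it once. Infinite trees are compared to
-- every finite depth, which turns coinduction into induction on the depth. Environments assign
-- arbitrary trees to variables, so that a contraction can be split into a substitution in the tree
-- and one in the term. Arguments of constructors and alternatives are functions, hence terms equal
-- after a trivial renaming are equal only pointwise; this is why relations between environments are
-- carried along instead of equations between terms.

module Adequacy (𝒮 : Signature) where
  open Signature 𝒮
  open Calculus 𝒮

  -- Substitution on labellings

  infix 4 _≐_ _≈ˢ_

  _≐_ : Labelling → Labelling → Set
  S ≐ T = ∀ p → S p ≡ T p

  _≈ˢ_ : (ℕ → InfExpr) → (ℕ → InfExpr) → Set
  σ ≈ˢ τ = ∀ x → σ x ≈ τ x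

  NonVar : Label → Set
  NonVar (var _) = ⊥
  NonVar _       = ⊤

  -- The catch-all clauses of `subAt` compute only on concrete labels. This view does that analysis
  -- once, leaving three cases instead of nine to the proofs about substitution.
  data Root (S : Labelling) : Set where
    none : S [] ≡ nothing → Root S
    var  : ∀ {x} → S [] ≡ just (var x) → Root S
    inner : ∀ {ℓ} → S [] ≡ just ℓ → NonVar ℓ → Root S

  root : ∀ S → Root S
  root S with S [] in eq
  ... | nothing          = none eq
  ... | just (var x)     = var eq
  ... | just app         = inner eq tt
  ... | just lam         = inner eq tt
  ... | just bot         = inner eq tt
  ... | just (con T c)   = inner eq tt
  ... | just seq         = inner eq tt
  ... | just (case T)    = inner eq tt
  ... | just (alt T c)   = inner eq tt

  ren-none : ∀ ρ S → S [] ≡ nothing → ∀ p → renLabelling ρ S p ≡ nothing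
  ren-none ρ S eq p rewrite eq = refl

  ren-[] : ∀ ρ S {ℓ} → S [] ≡ just ℓ → renLabelling ρ S [] ≡ just (renLabel ρ ℓ)
  ren-[] ρ S eq rewrite eq = refl

  ren-∷ : ∀ ρ S {ℓ} → S [] ≡ just ℓ → ∀ i →
          renLabelling ρ S / i ≐ renLabelling (liftRenᵗ (binders ℓ) ρ) (S / i)
  ren-∷ ρ S eq i p rewrite eq = refl

  sub-none : ∀ σ S → S [] ≡ nothing → ∀ p → subLabelling σ S p ≡ nothing
  sub-none σ S eq p rewrite eq = refl

  sub-var : ∀ σ S {x} → S [] ≡ just (var x) → subLabelling σ S ≐ label (σ x)
  sub-var σ S eq p rewrite eq = refl

  sub-[] : ∀ σ S {ℓ} → S [] ≡ just ℓ → NonVar ℓ → subLabelling σ S [] ≡ just ℓ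
  sub-[] σ S {ℓ = app}     eq _ rewrite eq = refl
  sub-[] σ S {ℓ = lam}     eq _ rewrite eq = refl
  sub-[] σ S {ℓ = bot}     eq _ rewrite eq = refl
  sub-[] σ S {ℓ = con T c} eq _ rewrite eq = refl
  sub-[] σ S {ℓ = seq}     eq _ rewrite eq = refl
  sub-[] σ S {ℓ = case T}  eq _ rewrite eq = refl
  sub-[] σ S {ℓ = alt T c} eq _ rewrite eq = refl

  sub-∷ : ∀ σ S {ℓ} → S [] ≡ just ℓ → NonVar ℓ → ∀ i →
          subLabelling σ S / i ≐ subLabelling (liftSubᵗ (binders ℓ) σ) (S / i)
  sub-∷ σ S {ℓ = app}     eq _ i p rewrite eq = refl
  sub-∷ σ S {ℓ = lam}     eq _ i p rewrite eq = refl
  sub-∷ σ S {ℓ = bot}     eq _ i p rewrite eq = refl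
  sub-∷ σ S {ℓ = con T c} eq _ i p rewrite eq = refl
  sub-∷ σ S {ℓ = seq}     eq _ i p rewrite eq = refl
  sub-∷ σ S {ℓ = case T}  eq _ i p rewrite eq = refl
  sub-∷ σ S {ℓ = alt T c} eq _ i p rewrite eq = refl

  renLabel-NonVar : ∀ {ρ ℓ} → NonVar ℓ → renLabel ρ ℓ ≡ ℓ
  renLabel-NonVar {ℓ = app}     _ = refl
  renLabel-NonVar {ℓ = lam}     _ = refl
  renLabel-NonVar {ℓ = bot}     _ = refl
  renLabel-NonVar {ℓ = con T c} _ = refl
  renLabel-NonVar {ℓ = seq}     _ = refl
  renLabel-NonVar {ℓ = case T}  _ = refl
  renLabel-NonVar {ℓ = alt T c} _ = refl

  binders-ren : ∀ ρ ℓ → binders (renLabel ρ ℓ) ≡ binders ℓ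
  binders-ren ρ (var x)   = refl
  binders-ren ρ app       = refl
  binders-ren ρ lam       = refl
  binders-ren ρ bot       = refl
  binders-ren ρ (con T c) = refl
  binders-ren ρ seq       = refl
  binders-ren ρ (case T)  = refl
  binders-ren ρ (alt T c) = refl

  renLabel-∘ : ∀ ρ ρ′ ℓ → renLabel ρ (renLabel ρ′ ℓ) ≡ renLabel (ρ ∘ ρ′) ℓ
  renLabel-∘ ρ ρ′ (var x)   = refl
  renLabel-∘ ρ ρ′ app       = refl
  renLabel-∘ ρ ρ′ lam       = refl
  renLabel-∘ ρ ρ′ bot       = refl
  renLabel-∘ ρ ρ′ (con T c) = refl
  renLabel-∘ ρ ρ′ seq       = refl
  renLabel-∘ ρ ρ′ (case T)  = refl
  renLabel-∘ ρ ρ′ (alt T c) = refl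

  renLabel-cong : ∀ {ρ ρ′} → (∀ x → ρ x ≡ ρ′ x) → ∀ ℓ → renLabel ρ ℓ ≡ renLabel ρ′ ℓ
  renLabel-cong eq (var x)   = cong var (eq x)
  renLabel-cong eq app       = refl
  renLabel-cong eq lam       = refl
  renLabel-cong eq bot       = refl
  renLabel-cong eq (con T c) = refl
  renLabel-cong eq seq       = refl
  renLabel-cong eq (case T)  = refl
  renLabel-cong eq (alt T c) = refl

  liftRenᵗ-cong : ∀ k {ρ ρ′} → (∀ x → ρ x ≡ ρ′ x) → ∀ x → liftRenᵗ k ρ x ≡ liftRenᵗ k ρ′ x
  liftRenᵗ-cong zero    eq x       = eq x
  liftRenᵗ-cong (suc k) eq zero    = refl
  liftRenᵗ-cong (suc k) eq (suc x) = cong suc (liftRenᵗ-cong k eq x)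

  liftRenᵗ-∘ : ∀ k ρ ρ′ x → liftRenᵗ k ρ (liftRenᵗ k ρ′ x) ≡ liftRenᵗ k (ρ ∘ ρ′) x
  liftRenᵗ-∘ zero    ρ ρ′ x       = refl
  liftRenᵗ-∘ (suc k) ρ ρ′ zero    = refl
  liftRenᵗ-∘ (suc k) ρ ρ′ (suc x) = cong suc (liftRenᵗ-∘ k ρ ρ′ x)

  ren-cong : ∀ ρ ρ′ S S′ → (∀ x → ρ x ≡ ρ′ x) → S ≐ S′ →
             renLabelling ρ S ≐ renLabelling ρ′ S′
  ren-cong ρ ρ′ S S′ eq eqS p with S [] in r
  ren-cong ρ ρ′ S S′ eq eqS p       | nothing = sym (ren-none ρ′ S′ (trans (sym (eqS [])) r) p)
  ren-cong ρ ρ′ S S′ eq eqS []      | just ℓ  =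
    trans (cong just (renLabel-cong eq ℓ)) (sym (ren-[] ρ′ S′ (trans (sym (eqS [])) r)))
  ren-cong ρ ρ′ S S′ eq eqS (i ∷ p) | just ℓ  =
    trans (ren-cong _ _ (S / i) (S′ / i) (liftRenᵗ-cong (binders ℓ) eq) (λ q → eqS (i ∷ q)) p)
          (sym (ren-∷ ρ′ S′ (trans (sym (eqS [])) r) i p))

  ren-congʳ : ∀ ρ S S′ → S ≐ S′ → renLabelling ρ S ≐ renLabelling ρ S′
  ren-congʳ ρ S S′ = ren-cong ρ ρ S S′ (λ _ → refl)

  ren-∘ : ∀ ρ ρ′ S → renLabelling ρ (renLabelling ρ′ S) ≐ renLabelling (ρ ∘ ρ′) S
  ren-∘ ρ ρ′ S p with S [] in r
  ren-∘ ρ ρ′ S p       | nothing = refl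
  ren-∘ ρ ρ′ S []      | just ℓ  = cong just (renLabel-∘ ρ ρ′ ℓ)
  ren-∘ ρ ρ′ S (i ∷ p) | just ℓ rewrite binders-ren ρ′ ℓ =
    trans (ren-∘ _ _ (S / i) p)
          (ren-cong _ _ (S / i) (S / i) (liftRenᵗ-∘ (binders ℓ) ρ ρ′) (λ _ → refl) p)

  liftSubᵗ-cong : ∀ k {σ σ′} → σ ≈ˢ σ′ → liftSubᵗ k σ ≈ˢ liftSubᵗ k σ′
  liftSubᵗ-cong zero    eq x       = eq x
  liftSubᵗ-cong (suc k) eq zero    = λ _ → refl
  liftSubᵗ-cong (suc k) eq (suc x) = ren-congʳ suc _ _ (liftSubᵗ-cong k eq x)

  sub-cong : ∀ σ σ′ S S′ → σ ≈ˢ σ′ → S ≐ S′ → subLabelling σ S ≐ subLabelling σ′ S′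
  sub-cong σ σ′ S S′ eq eqS p with root S
  ... | none r = trans (sub-none σ S r p) (sym (sub-none σ′ S′ (trans (sym (eqS [])) r) p))
  ... | var {x} r =
    trans (sub-var σ S r p)
   (trans (eq x p) (sym (sub-var σ′ S′ (trans (sym (eqS [])) r) p)))
  sub-cong σ σ′ S S′ eq eqS [] | inner r nv =
    trans (sub-[] σ S r nv) (sym (sub-[] σ′ S′ (trans (sym (eqS [])) r) nv))
  sub-cong σ σ′ S S′ eq eqS (i ∷ p) | inner {ℓ} r nv =
    trans (sub-∷ σ S r nv i p)
   (trans (sub-cong _ _ (S / i) (S′ / i) (liftSubᵗ-cong (binders ℓ) eq) (λ q → eqS (i ∷ q)) p)
          (sym (sub-∷ σ′ S′ (trans (sym (eqS [])) r) nv i p)))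

  sub-congˡ : ∀ σ σ′ S → σ ≈ˢ σ′ → subLabelling σ S ≐ subLabelling σ′ S
  sub-congˡ σ σ′ S eq = sub-cong σ σ′ S S eq (λ _ → refl)

  sub-congʳ : ∀ σ S S′ → S ≐ S′ → subLabelling σ S ≐ subLabelling σ S′
  sub-congʳ σ S S′ = sub-cong σ σ S S′ (λ _ _ → refl)

  liftSubᵗ-liftRenᵗ : ∀ k τ ρ x → liftSubᵗ k τ (liftRenᵗ k ρ x) ≈ liftSubᵗ k (τ ∘ ρ) x
  liftSubᵗ-liftRenᵗ zero    τ ρ x       = λ _ → refl
  liftSubᵗ-liftRenᵗ (suc k) τ ρ zero    = λ _ → refl
  liftSubᵗ-liftRenᵗ (suc k) τ ρ (suc x) = ren-congʳ suc _ _ (liftSubᵗ-liftRenᵗ k τ ρ x)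

  sub-ren : ∀ τ ρ S → subLabelling τ (renLabelling ρ S) ≐ subLabelling (τ ∘ ρ) S
  sub-ren τ ρ S p with root S
  ... | none r = trans (sub-none τ (renLabelling ρ S) (ren-none ρ S r []) p)
                       (sym (sub-none (τ ∘ ρ) S r p))
  ... | var r = trans (sub-var τ (renLabelling ρ S) (ren-[] ρ S r) p)
                      (sym (sub-var (τ ∘ ρ) S r p))
  sub-ren τ ρ S p | inner {ℓ} r nv with trans (ren-[] ρ S r) (cong just (renLabel-NonVar nv))
  sub-ren τ ρ S [] | inner r nv | r′ =
    trans (sub-[] τ (renLabelling ρ S) r′ nv) (sym (sub-[] (τ ∘ ρ) S r nv))
  sub-ren τ ρ S (i ∷ p) | inner {ℓ} r nv | r′ =
    trans (sub-∷ τ (renLabelling ρ S) r′ nv i p)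
   (trans (sub-congʳ (liftSubᵗ (binders ℓ) τ) _ _ (ren-∷ ρ S r i) p)
   (trans (sub-ren _ _ (S / i) p)
   (trans (sub-congˡ _ _ (S / i) (liftSubᵗ-liftRenᵗ (binders ℓ) τ ρ) p)
          (sym (sub-∷ (τ ∘ ρ) S r nv i p)))))

  liftRenᵗ-liftSubᵗ : ∀ k ρ τ x →
                      renᵗ (liftRenᵗ k ρ) (liftSubᵗ k τ x) ≈ liftSubᵗ k (renᵗ ρ ∘ τ) x
  liftRenᵗ-liftSubᵗ zero    ρ τ x       = λ _ → refl
  liftRenᵗ-liftSubᵗ (suc k) ρ τ zero    = λ { [] → refl ; (i ∷ p) → refl }
  liftRenᵗ-liftSubᵗ (suc k) ρ τ (suc x) p =
    -- Lifting commutes with `suc` by definition, so both composites fuse to the renaming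
    -- `suc ∘ liftRenᵗ k ρ`.
    trans (ren-∘ _ suc S p)
   (trans (sym (ren-∘ suc (liftRenᵗ k ρ) S p))
          (ren-congʳ suc _ _ (liftRenᵗ-liftSubᵗ k ρ τ x) p))
    where S = label (liftSubᵗ k τ x)

  ren-sub : ∀ ρ τ S → renLabelling ρ (subLabelling τ S) ≐ subLabelling (renᵗ ρ ∘ τ) S
  ren-sub ρ τ S p with root S
  ... | none r = trans (ren-none ρ (subLabelling τ S) (sub-none τ S r []) p)
                       (sym (sub-none (renᵗ ρ ∘ τ) S r p))
  ... | var {x} r = trans (ren-congʳ ρ _ _ (sub-var τ S r) p)
                          (sym (sub-var (renᵗ ρ ∘ τ) S r p))
  ren-sub ρ τ S [] | inner r nv =
    trans (trans (ren-[] ρ (subLabelling τ S) (sub-[] τ S r nv))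
                 (cong just (renLabel-NonVar nv)))
          (sym (sub-[] (renᵗ ρ ∘ τ) S r nv))
  ren-sub ρ τ S (i ∷ p) | inner {ℓ} r nv =
    trans (ren-∷ ρ (subLabelling τ S) (sub-[] τ S r nv) i p)
   (trans (ren-congʳ (liftRenᵗ (binders ℓ) ρ) _ _ (sub-∷ τ S r nv i) p)
   (trans (ren-sub _ _ (S / i) p)
   (trans (sub-congˡ _ _ (S / i) (liftRenᵗ-liftSubᵗ (binders ℓ) ρ τ) p)
          (sym (sub-∷ (renᵗ ρ ∘ τ) S r nv i p)))))

  ren-var : ∀ ρ x → renᵗ ρ (varᵗ x) ≈ varᵗ (ρ x)
  ren-var ρ x []      = refl
  ren-var ρ x (i ∷ p) = refl

  liftSubᵗ-var : ∀ k {σ} → σ ≈ˢ varᵗ → liftSubᵗ k σ ≈ˢ varᵗ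
  liftSubᵗ-var zero    eq x       = eq x
  liftSubᵗ-var (suc k) eq zero    = λ _ → refl
  liftSubᵗ-var (suc k) eq (suc x) p =
    trans (ren-congʳ suc _ _ (liftSubᵗ-var k eq x) p) (ren-var suc x p)

  -- This fails for arbitrary labellings: substitution discards whatever is recorded below a
  -- variable or below a missing label. Conformance excludes such leftovers, and is needed only as
  -- deep as `p` reaches, which permits induction on `p`.
  sub-id-conforms : ∀ p {κ} S {σ} → σ ≈ˢ varᵗ → Conforms (suc (length p)) κ S →
                    subLabelling σ S p ≡ S p
  sub-id-conforms p S eq c with root S
  sub-id-conforms p S eq (ℓ , r , _) | none r′ with () ← trans (sym r) r′
  sub-id-conforms [] S {σ} eq c | var {x} r =
    trans (sub-var σ S r []) (trans (eq x []) (sym r))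
  sub-id-conforms (i ∷ p) S {σ} eq (ℓ , r , _ , _ , out) | var {x} r′ with trans (sym r) r′
  ... | refl = trans (sub-var σ S r (i ∷ p)) (trans (eq x (i ∷ p)) (sym (out i z≤n p)))
  sub-id-conforms [] S {σ} eq c | inner r nv = trans (sub-[] σ S r nv) (sym r)
  sub-id-conforms (i ∷ p) S {σ} eq (ℓ , r , _ , ok , out) | inner {ℓ′} r′ nv
    with i <? rank ℓ
  ... | no i≮r = trans (sub-∷ σ S r′ nv i p)
                (trans (sub-none (liftSubᵗ (binders ℓ′) σ) (S / i) (out i (≮⇒≥ i≮r) []) p)
                       (sym (out i (≮⇒≥ i≮r) p)))
  ... | yes i<r = trans (sub-∷ σ S r′ nv i p)
                        (sub-id-conforms p (S / i) (liftSubᵗ-var (binders ℓ′) eq) c)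
    where
    c : Conforms (suc (length p)) (childSort ℓ (fromℕ< i<r)) (S / i)
    c = ≡.subst (λ j → Conforms (suc (length p)) (childSort ℓ (fromℕ< i<r)) (S / j)) (toℕ-fromℕ< i<r) (ok (fromℕ< i<r))

  sub-id : ∀ {σ} → σ ≈ˢ varᵗ → ∀ S → subᵗ σ S ≈ S
  sub-id eq S p = sub-id-conforms p (label S) eq (conforms S (suc (length p)))

  -- Inserting the identity substitution and fusing it with the renaming avoids another induction on
  -- positions.
  sub-vars : ∀ ρ S → subᵗ (varᵗ ∘ ρ) S ≈ renᵗ ρ S
  sub-vars ρ S p = sym
    (trans (ren-congʳ ρ _ _ (λ q → sym (sub-id (λ _ _ → refl) S q)) p)
    (trans (ren-sub ρ varᵗ (label S) p)
           (sub-congˡ (renᵗ ρ ∘ varᵗ) (varᵗ ∘ ρ) (label S) (ren-var ρ) p)))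

  liftSubᵗ-↑ : ∀ k τ x → liftSubᵗ k τ (k + x) ≈ renᵗ (k +_) (τ x)
  liftSubᵗ-↑ zero    τ x p =
    -- Renaming by the identity is trivial only up to `≈`; it becomes a substitution by variables,
    -- to which `sub-id` applies.
    sym (trans (sym (sub-vars (0 +_) (τ x) p)) (sub-id (λ _ _ → refl) (τ x) p))
  liftSubᵗ-↑ (suc k) τ x p =
    trans (ren-congʳ suc _ _ (liftSubᵗ-↑ k τ x) p) (ren-∘ suc (k +_) (label (τ x)) p)

  sub-lift-ren : ∀ k τ S → subᵗ (liftSubᵗ k τ) (renᵗ (k +_) S) ≈ renᵗ (k +_) (subᵗ τ S)
  sub-lift-ren k τ S p =
    trans (sub-ren (liftSubᵗ k τ) (k +_) (label S) p)
   (trans (sub-congˡ _ _ (label S) (liftSubᵗ-↑ k τ) p) (sym (ren-sub (k +_) τ (label S) p)))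

  -- Walks under environments

  -- Generalises `Env`: a variable that is not letrec-bound may stand for any tree, not only for
  -- itself.
  data GEnv : ℕ → Set where
    base : ∀ {n} → (Fin n → InfExpr) → GEnv n
    ext  : ∀ {k n} → (Fin k → InfExpr) → GEnv n → GEnv (k + n)
    rec  : ∀ {k n} → (Fin (suc k) → Expr (suc k + n)) → GEnv n → GEnv (suc k + n)

  data Look : Set where
    tree : InfExpr → Look
    clo  : ∀ {k n} → (Fin (suc k) → Expr (suc k + n)) → GEnv n → Fin (suc k) → Look

  look : ∀ {n} → GEnv n → Fin n → Look
  look (base Ss)       x = tree (Ss x)
  look (ext {k} Ss γ)  x = [ tree ∘ Ss , look γ ] (splitAt k x)
  look (rec {k} bs γ)  x = [ clo bs γ , look γ ] (splitAt (suc k) x)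

  -- Term scopes and tree indices are independent, because a letrec extends only the former.
  -- Renaming the trees thus changes neither the scope nor the texts of the bindings.
  renEnv : ∀ {n} → (ℕ → ℕ) → GEnv n → GEnv n
  renEnv ρ (base Ss)  = base (renᵗ ρ ∘ Ss)
  renEnv ρ (ext Ss γ) = ext (renᵗ ρ ∘ Ss) (renEnv ρ γ)
  renEnv ρ (rec bs γ) = rec bs (renEnv ρ γ)

  renLook : (ℕ → ℕ) → Look → Look
  renLook ρ (tree S)     = tree (renᵗ ρ S)
  renLook ρ (clo bs γ i) = clo bs (renEnv ρ γ) i

  underᵍ : ∀ k {n} → GEnv n → GEnv (k + n)
  underᵍ k γ = ext (varᵗ ∘ toℕ) (renEnv (k +_) γ)

  data Head : Set where
    tree : InfExpr → Head
    hd   : ∀ {n} → GEnv n → Expr n → Head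

  -- The number bounds how many letrec-bound variables may be hit.
  run     : ∀ {n} → ℕ → GEnv n → Expr n → Maybe Head
  runLook : ℕ → Look → Maybe Head

  run h γ (var x)        = runLook h (look γ x)
  run h γ (letrec bs t)  = run h (rec bs γ) t
  run h γ (app s t)      = just (hd γ (app s t))
  run h γ (lam s)        = just (hd γ (lam s))
  run h γ (con T c ss)   = just (hd γ (con T c ss))
  run h γ (seq s t)      = just (hd γ (seq s t))
  run h γ (case T s as)  = just (hd γ (case T s as))

  runLook h       (tree S)     = just (tree S)
  runLook zero    (clo bs γ i) = nothing
  runLook (suc h) (clo bs γ i) = run h (rec bs γ) (bs i)

  -- The number is the depth down to which expression and tree are compared.
  data Sim   : ∀ {n} → ℕ → GEnv n → Expr n → Labelling → Set
  data Match : ℕ → Head → Labelling → Set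

  data Sim where
    zero : ∀ {n} {γ : GEnv n} {s S} → Sim zero γ s S
    runs : ∀ {n d} {γ : GEnv n} {s S} h {H} →
           run h γ s ≡ just H → Match d H S → Sim (suc d) γ s S
    bot  : ∀ {n d} {γ : GEnv n} {s S} →
           (∀ h → run h γ s ≡ nothing) → S [] ≡ just bot → Sim (suc d) γ s S

  data Match where
    tree : ∀ {d T S} → S ≐ label T → Match d (tree T) S
    app  : ∀ {n d} {γ : GEnv n} {s t S} → S [] ≡ just app →
           Sim d γ s (S / 0) → Sim d γ t (S / 1) → Match d (hd γ (app s t)) S
    lam  : ∀ {n d} {γ : GEnv n} {s S} → S [] ≡ just lam →
           Sim d (underᵍ 1 γ) s (S / 0) → Match d (hd γ (lam s)) S
    con  : ∀ {n d} {γ : GEnv n} {T c ss S} → S [] ≡ just (con T c) →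
           (∀ j → Sim d γ (ss j) (S / toℕ j)) → Match d (hd γ (con T c ss)) S
    seq  : ∀ {n d} {γ : GEnv n} {s t S} → S [] ≡ just seq →
           Sim d γ s (S / 0) → Sim d γ t (S / 1) → Match d (hd γ (seq s t)) S
    case : ∀ {n d} {γ : GEnv n} {T s as S} → S [] ≡ just (case T) →
           Sim d γ s (S / 0) →
           (∀ c → S (suc (toℕ c) ∷ []) ≡ just (alt T c)) →
           (∀ c → Sim d (underᵍ (ar T c) γ) (as c) (S / suc (toℕ c) / 0)) →
           Match d (hd γ (case T s as)) S

  infix 4 _⊢_∼_
  _⊢_∼_ : ∀ {n} → GEnv n → Expr n → Labelling → Set
  γ ⊢ s ∼ S = ∀ d → Sim d γ s S

  run-mono : ∀ {n h h′ H} {γ : GEnv n} s → h ≤ h′ → run h γ s ≡ just H → run h′ γ s ≡ just H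
  runLook-mono : ∀ {h h′ H} l → h ≤ h′ → runLook h l ≡ just H → runLook h′ l ≡ just H

  run-mono {γ = γ} (var x) h≤ eq = runLook-mono (look γ x) h≤ eq
  run-mono (letrec bs t)   h≤ eq = run-mono t h≤ eq
  run-mono (app s t)       h≤ eq = eq
  run-mono (lam s)         h≤ eq = eq
  run-mono (con T c ss)    h≤ eq = eq
  run-mono (seq s t)       h≤ eq = eq
  run-mono (case T s as)   h≤ eq = eq

  runLook-mono (tree S)     h≤       eq = eq
  runLook-mono (clo bs γ i) (s≤s h≤) eq = run-mono (bs i) h≤ eq

  run-det : ∀ {n h h′ H H′} {γ : GEnv n} s →
            run h γ s ≡ just H → run h′ γ s ≡ just H′ → H ≡ H′
  run-det {h = h} {h′} s eq eq′ with ≤-total h h′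
  ... | inj₁ h≤ = just-injective (trans (sym (run-mono s h≤ eq)) eq′)
  ... | inj₂ h≤ = just-injective (trans (sym eq) (run-mono s h≤ eq′))

  Sim-resp   : ∀ {d n S S′} {γ : GEnv n} {s} → S ≐ S′ → Sim d γ s S → Sim d γ s S′
  Match-resp : ∀ {d H S S′} → S ≐ S′ → Match d H S → Match d H S′

  Sim-resp eq zero          = zero
  Sim-resp eq (runs h r m)  = runs h r (Match-resp eq m)
  Sim-resp eq (bot r b)     = bot r (trans (sym (eq [])) b)

  Match-resp eq (tree e)      = tree (λ p → trans (sym (eq p)) (e p))
  Match-resp eq (app e m n)   = app (trans (sym (eq [])) e)
    (Sim-resp (λ p → eq (0 ∷ p)) m) (Sim-resp (λ p → eq (1 ∷ p)) n)
  Match-resp eq (lam e m)     = lam (trans (sym (eq [])) e) (Sim-resp (λ p → eq (0 ∷ p)) m)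
  Match-resp eq (con e ms)    = con (trans (sym (eq [])) e)
    (λ j → Sim-resp (λ p → eq (toℕ j ∷ p)) (ms j))
  Match-resp eq (seq e m n)   = seq (trans (sym (eq [])) e)
    (Sim-resp (λ p → eq (0 ∷ p)) m) (Sim-resp (λ p → eq (1 ∷ p)) n)
  Match-resp eq (case e m es ms) = case (trans (sym (eq [])) e)
    (Sim-resp (λ p → eq (0 ∷ p)) m) (λ c → trans (sym (eq (suc (toℕ c) ∷ []))) (es c))
    (λ c → Sim-resp (λ p → eq (suc (toℕ c) ∷ 0 ∷ p)) (ms c))

  -- By `Pointwise`, for each fuel both walks stop or neither does, which serves both `runs` and
  -- `bot`. Renaming and tree substitution have this form; term substitution does not, as an
  -- inserted term needs fuel of its own.
  Sim-transfer : ∀ {R : Head → Head → Set} {d m n} {γ : GEnv m} {γ′ : GEnv n} {s s′ S S′} →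
    (∀ h → Pointwise R (run h γ s) (run h γ′ s′)) →
    (∀ {H H′} → R H H′ → Match d H S → Match d H′ S′) →
    (S [] ≡ just bot → S′ [] ≡ just bot) →
    Sim (suc d) γ s S → Sim (suc d) γ′ s′ S′
  Sim-transfer {γ′ = γ′} {s′ = s′} rel match b (runs h r m) with run h γ′ s′ in r′ | rel h
  ... | just _  | q rewrite r with just q′ ← q = runs h r′ (match q′ m)
  ... | nothing | q rewrite r with () ← q
  Sim-transfer {γ′ = γ′} {s′ = s′} rel match b (bot r e) = bot stuck (b e)
    where
    stuck : ∀ h → run h γ′ s′ ≡ nothing
    stuck h with run h γ′ s′ | rel h
    ... | nothing | _ = refl
    ... | just _  | q rewrite r h with () ← q

  -- Renaming

  -- `same` relates a binding to itself: a closure reached through a weakened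
  -- variable is unchanged, while renaming it by the identity would only give
  -- a pointwise equal expression.
  data Ren {m n} (ρ : Fin m → Fin n) (γ : GEnv m) (γ′ : GEnv n) : Set
  data RenLook : Look → Look → Set

  data Ren ρ γ γ′ where
    ren : (∀ x → RenLook (look γ x) (look γ′ (ρ x))) → Ren ρ γ γ′

  data RenLook where
    same : ∀ {l} → RenLook l l
    clo  : ∀ {k m n γ γ′ i} {bs : Fin (suc k) → Expr (suc k + m)} (ρ : Fin m → Fin n) →
           Ren ρ γ γ′ → RenLook (clo bs γ i) (clo (rename (liftRen (suc k) ρ) ∘ bs) γ′ i)

  data RenHead : Head → Head → Set where
    same : ∀ {H} → RenHead H H
    hd   : ∀ {m n γ γ′ w} (ρ : Fin m → Fin n) → Ren ρ γ γ′ → RenHead (hd γ w) (hd γ′ (rename ρ w))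

  Ren-rec : ∀ {k m n} (ρ : Fin m → Fin n) {γ γ′} (bs : Fin (suc k) → Expr (suc k + m)) →
            Ren ρ γ γ′ →
            Ren (liftRen (suc k) ρ) (rec bs γ) (rec (rename (liftRen (suc k) ρ) ∘ bs) γ′)
  Ren-rec {k} {n = n} ρ {γ} {γ′} bs (ren r) = ren go
    where
    go : ∀ x → RenLook (look (rec bs γ) x)
                       (look (rec (rename (liftRen (suc k) ρ) ∘ bs) γ′) (liftRen (suc k) ρ x))
    go x with splitAt (suc k) x
    ... | inj₁ i rewrite splitAt-↑ˡ (suc k) i n     = clo ρ (ren r)
    ... | inj₂ y rewrite splitAt-↑ʳ (suc k) n (ρ y) = r y

  Ren-ext : ∀ {k m n} (ρ : Fin m → Fin n) {γ γ′} (Ss : Fin k → InfExpr) →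
            Ren ρ γ γ′ → Ren (liftRen k ρ) (ext Ss γ) (ext Ss γ′)
  Ren-ext {k} {n = n} ρ {γ} {γ′} Ss (ren r) = ren go
    where
    go : ∀ x → RenLook (look (ext Ss γ) x) (look (ext Ss γ′) (liftRen k ρ x))
    go x with splitAt k x
    ... | inj₁ i rewrite splitAt-↑ˡ k i n     = same
    ... | inj₂ y rewrite splitAt-↑ʳ k n (ρ y) = r y

  look-renEnv : ∀ {n} ρ (γ : GEnv n) x → look (renEnv ρ γ) x ≡ renLook ρ (look γ x)
  look-renEnv ρ (base Ss) x = refl
  look-renEnv ρ (ext {k} Ss γ) x with splitAt k x
  ... | inj₁ i = refl
  ... | inj₂ y = look-renEnv ρ γ y
  look-renEnv ρ (rec {k} bs γ) x with splitAt (suc k) x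
  ... | inj₁ i = refl
  ... | inj₂ y = look-renEnv ρ γ y

  RenLook-renLook : ∀ ρ {l l′} → RenLook l l′ → RenLook (renLook ρ l) (renLook ρ l′)
  RenLook-renLook ρ same = same
  RenLook-renLook ρ (clo {γ = γ} {γ′} θ (ren r)) = clo θ (ren λ x →
    ≡.subst₂ RenLook (sym (look-renEnv ρ γ x)) (sym (look-renEnv ρ γ′ (θ x)))
             (RenLook-renLook ρ (r x)))

  Ren-under : ∀ k {m n} (ρ : Fin m → Fin n) {γ γ′} →
              Ren ρ γ γ′ → Ren (liftRen k ρ) (underᵍ k γ) (underᵍ k γ′)
  Ren-under k ρ {γ} {γ′} (ren r) = Ren-ext ρ (varᵗ ∘ toℕ) (ren λ x →
    ≡.subst₂ RenLook (sym (look-renEnv (k +_) γ x)) (sym (look-renEnv (k +_) γ′ (ρ x)))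
             (RenLook-renLook (k +_) (r x)))

  RenHead-refl : ∀ m → Pointwise RenHead m m
  RenHead-refl (just H) = just same
  RenHead-refl nothing  = nothing

  run-ren     : ∀ h {m n} (ρ : Fin m → Fin n) {γ γ′} s → Ren ρ γ γ′ →
                Pointwise RenHead (run h γ s) (run h γ′ (rename ρ s))
  runLook-ren : ∀ h {l l′} → RenLook l l′ → Pointwise RenHead (runLook h l) (runLook h l′)

  run-ren h ρ (var x) (ren r) = runLook-ren h (r x)
  run-ren h ρ (letrec bs t) r = run-ren h _ t (Ren-rec ρ bs r)
  run-ren h ρ (app s t)     r = just (hd ρ r)
  run-ren h ρ (lam s)       r = just (hd ρ r)
  run-ren h ρ (con T c ss)  r = just (hd ρ r)
  run-ren h ρ (seq s t)     r = just (hd ρ r)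
  run-ren h ρ (case T s as) r = just (hd ρ r)

  runLook-ren h       {l} same              = RenHead-refl (runLook h l)
  runLook-ren zero    (clo ρ r)             = nothing
  runLook-ren (suc h) (clo {i = i} {bs} ρ r) = run-ren h _ (bs i) (Ren-rec ρ bs r)

  Sim-ren   : ∀ d {m n} (ρ : Fin m → Fin n) {γ γ′ s S} → Ren ρ γ γ′ →
              Sim d γ s S → Sim d γ′ (rename ρ s) S
  Match-ren : ∀ d {H H′ S} → RenHead H H′ → Match d H S → Match d H′ S

  Sim-ren zero    ρ r m = zero
  Sim-ren (suc d) ρ {s = s} r m =
    Sim-transfer (λ h → run-ren h ρ s r) (Match-ren d) (λ e → e) m

  Match-ren d same     m             = m
  Match-ren d (hd ρ r) (app e m n)   = app e (Sim-ren d ρ r m) (Sim-ren d ρ r n)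
  Match-ren d (hd ρ r) (lam e m)     = lam e (Sim-ren d _ (Ren-under 1 ρ r) m)
  Match-ren d (hd ρ r) (con e ms)    = con e (λ j → Sim-ren d ρ r (ms j))
  Match-ren d (hd ρ r) (seq e m n)   = seq e (Sim-ren d ρ r m) (Sim-ren d ρ r n)
  Match-ren d (hd ρ r) (case {T = T} e m es ms) =
    case e (Sim-ren d ρ r m) es (λ c → Sim-ren d _ (Ren-under (ar T c) ρ r) (ms c))

  Ren-weaken-rec : ∀ {k n} {γ : GEnv n} (bs : Fin (suc k) → Expr (suc k + n)) →
                   Ren (suc k ↑ʳ_) γ (rec bs γ)
  Ren-weaken-rec {k} {n} {γ} bs = ren go
    where
    go : ∀ x → RenLook (look γ x) (look (rec bs γ) (suc k ↑ʳ x))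
    go x rewrite splitAt-↑ʳ (suc k) n x = same

  -- Tree substitution in the environment

  -- A relation and not a map on environments, since the trees have to agree only up to `≈`. It
  -- thereby also covers renamed environments and environments whose shift is cancelled by `τ`.
  data SubEnv {n} (τ : ℕ → InfExpr) (γ γ′ : GEnv n) : Set
  data SubLook (τ : ℕ → InfExpr) : Look → Look → Set

  data SubEnv τ γ γ′ where
    sub : (∀ x → SubLook τ (look γ x) (look γ′ x)) → SubEnv τ γ γ′

  data SubLook τ where
    tree : ∀ {S S′} → S′ ≈ subᵗ τ S → SubLook τ (tree S) (tree S′)
    clo  : ∀ {k n γ γ′ i} {bs : Fin (suc k) → Expr (suc k + n)} →
           SubEnv τ γ γ′ → SubLook τ (clo bs γ i) (clo bs γ′ i)

  data SubHead (τ : ℕ → InfExpr) : Head → Head → Set where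
    tree : ∀ {S S′} → S′ ≈ subᵗ τ S → SubHead τ (tree S) (tree S′)
    hd   : ∀ {n γ γ′} {w : Expr n} → SubEnv τ γ γ′ → SubHead τ (hd γ w) (hd γ′ w)

  SubEnv-rec : ∀ {τ k n γ γ′} (bs : Fin (suc k) → Expr (suc k + n)) →
               SubEnv τ γ γ′ → SubEnv τ (rec bs γ) (rec bs γ′)
  SubEnv-rec {τ} {k} {γ = γ} {γ′} bs (sub r) = sub go
    where
    go : ∀ x → SubLook τ (look (rec bs γ) x) (look (rec bs γ′) x)
    go x with splitAt (suc k) x
    ... | inj₁ i = clo (sub r)
    ... | inj₂ y = r y

  SubEnv-ext : ∀ {τ k n γ γ′} {Ss Ss′ : Fin k → InfExpr} → (∀ i → Ss′ i ≈ subᵗ τ (Ss i)) →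
               SubEnv {n} τ γ γ′ → SubEnv τ (ext Ss γ) (ext Ss′ γ′)
  SubEnv-ext {τ} {k} {γ = γ} {γ′} {Ss} {Ss′} eq (sub r) = sub go
    where
    go : ∀ x → SubLook τ (look (ext Ss γ) x) (look (ext Ss′ γ′) x)
    go x with splitAt k x
    ... | inj₁ i = tree (eq i)
    ... | inj₂ y = r y

  SubLook-renLook : ∀ k {τ l l′} → SubLook τ l l′ →
                    SubLook (liftSubᵗ k τ) (renLook (k +_) l) (renLook (k +_) l′)
  SubLook-renLook k {τ} (tree {S} eq) =
    tree (λ p → trans (ren-congʳ (k +_) _ _ eq p) (sym (sub-lift-ren k τ S p)))
  SubLook-renLook k (clo {γ = γ} {γ′} (sub r)) = clo (sub λ x →
    ≡.subst₂ (SubLook _) (sym (look-renEnv (k +_) γ x)) (sym (look-renEnv (k +_) γ′ x))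
             (SubLook-renLook k (r x)))

  liftSubᵗ-bound : ∀ {k} τ (i : Fin k) → varᵗ (toℕ i) ≈ liftSubᵗ k τ (toℕ i)
  liftSubᵗ-bound τ zero    p = refl
  liftSubᵗ-bound τ (suc i) p =
    trans (sym (ren-var suc (toℕ i) p)) (ren-congʳ suc _ _ (liftSubᵗ-bound τ i) p)

  SubEnv-under : ∀ k {n τ} {γ γ′ : GEnv n} →
                 SubEnv τ γ γ′ → SubEnv (liftSubᵗ k τ) (underᵍ k γ) (underᵍ k γ′)
  SubEnv-under k {τ = τ} {γ} {γ′} (sub r) = SubEnv-ext (liftSubᵗ-bound τ) (sub λ x →
    ≡.subst₂ (SubLook _) (sym (look-renEnv (k +_) γ x)) (sym (look-renEnv (k +_) γ′ x))
             (SubLook-renLook k (r x)))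

  -- A walk never looks into the trees of its environment, so its moves stay the same and only the
  -- tree at which it may end is affected.
  run-sub     : ∀ h {n τ} {γ γ′ : GEnv n} s → SubEnv τ γ γ′ →
                Pointwise (SubHead τ) (run h γ s) (run h γ′ s)
  runLook-sub : ∀ h {τ l l′} → SubLook τ l l′ →
                Pointwise (SubHead τ) (runLook h l) (runLook h l′)

  run-sub h (var x) (sub r) = runLook-sub h (r x)
  run-sub h (letrec bs t) r = run-sub h t (SubEnv-rec bs r)
  run-sub h (app s t)     r = just (hd r)
  run-sub h (lam s)       r = just (hd r)
  run-sub h (con T c ss)  r = just (hd r)
  run-sub h (seq s t)     r = just (hd r)
  run-sub h (case T s as) r = just (hd r)

  runLook-sub h       (tree eq)            = just (tree eq)
  runLook-sub zero    (clo r)              = nothing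
  runLook-sub (suc h) (clo {i = i} {bs} r) = run-sub h (bs i) (SubEnv-rec bs r)

  Sim-sub   : ∀ d {n} τ {γ γ′ : GEnv n} {s S} → SubEnv τ γ γ′ →
              Sim d γ s S → Sim d γ′ s (subLabelling τ S)
  Match-sub : ∀ d τ {H H′ S} → SubHead τ H H′ → Match d H S → Match d H′ (subLabelling τ S)

  Sim-sub zero    τ r m = zero
  Sim-sub (suc d) τ {s = s} {S} r m =
    Sim-transfer (λ h → run-sub h s r) (Match-sub d τ) (λ e → sub-[] τ S e tt) m

  Match-sub d τ {S = S} (tree {T} eq) (tree e) = tree λ p →
    trans (sub-congʳ τ S (label T) e p) (sym (eq p))
  Match-sub d τ {S = S} (hd r) (app e m n) = app (sub-[] τ S e tt)
    (Sim-resp (λ p → sym (sub-∷ τ S e tt 0 p)) (Sim-sub d τ r m))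
    (Sim-resp (λ p → sym (sub-∷ τ S e tt 1 p)) (Sim-sub d τ r n))
  Match-sub d τ {S = S} (hd r) (lam e m) = lam (sub-[] τ S e tt)
    (Sim-resp (λ p → sym (sub-∷ τ S e tt 0 p)) (Sim-sub d (liftSubᵗ 1 τ) (SubEnv-under 1 r) m))
  Match-sub d τ {S = S} (hd r) (con e ms) = con (sub-[] τ S e tt)
    (λ j → Sim-resp (λ p → sym (sub-∷ τ S e tt (toℕ j) p)) (Sim-sub d τ r (ms j)))
  Match-sub d τ {S = S} (hd r) (seq e m n) = seq (sub-[] τ S e tt)
    (Sim-resp (λ p → sym (sub-∷ τ S e tt 0 p)) (Sim-sub d τ r m))
    (Sim-resp (λ p → sym (sub-∷ τ S e tt 1 p)) (Sim-sub d τ r n))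
  Match-sub d τ {S = S} (hd r) (case {T = T} e m es ms) = case (sub-[] τ S e tt)
    (Sim-resp (λ p → sym (sub-∷ τ S e tt 0 p)) (Sim-sub d τ r m))
    (λ c → trans (sub-∷ τ S e tt (suc (toℕ c)) [])
                 (sub-[] τ (S / suc (toℕ c)) (es c) tt))
    (λ c → Sim-resp
      (λ p → sym (trans (sub-∷ τ S e tt (suc (toℕ c)) (0 ∷ p))
                        (sub-∷ τ (S / suc (toℕ c)) (es c) tt 0 p)))
      (Sim-sub d (liftSubᵗ (ar T c) τ) (SubEnv-under (ar T c) r) (ms c)))

  -- An instance of `Sim-sub`, renaming being the substitution of variables.
  ∼-renEnv : ∀ ρ {n} {γ : GEnv n} {s} S → γ ⊢ s ∼ label S → renEnv ρ γ ⊢ s ∼ label (renᵗ ρ S)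
  ∼-renEnv ρ {γ = γ} S m d = Sim-resp (sub-vars ρ S) (Sim-sub d (varᵗ ∘ ρ) (rel γ) (m d))
    where
    rel : ∀ {n} (γ : GEnv n) → SubEnv (varᵗ ∘ ρ) γ (renEnv ρ γ)
    rel (base Ss)  = sub λ x → tree λ p → sym (sub-vars ρ (Ss x) p)
    rel (ext Ss γ) = SubEnv-ext (λ i p → sym (sub-vars ρ (Ss i) p)) (rel γ)
    rel (rec bs γ) = SubEnv-rec bs (rel γ)

  -- Substitution of terms

  Sim-enter : ∀ {n k m d} {γ : GEnv n} {x S i} {bs : Fin (suc k) → Expr (suc k + m)} {γ₀} →
              look γ x ≡ clo bs γ₀ i → Sim d (rec bs γ₀) (bs i) S → Sim d γ (var x) S
  Sim-enter eq zero         = zero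
  Sim-enter eq (runs h r m) = runs (suc h) (trans (cong (runLook (suc h)) eq) r) m
  Sim-enter eq (bot r b)    =
    bot (λ { zero → cong (runLook 0) eq ; (suc h) → trans (cong (runLook (suc h)) eq) (r h) }) b

  Sim-letrec : ∀ {n k d} {γ : GEnv n} {bs : Fin (suc k) → Expr (suc k + n)} {t S} →
               Sim d (rec bs γ) t S → Sim d γ (letrec bs t) S
  Sim-letrec zero         = zero
  Sim-letrec (runs h r m) = runs h r m
  Sim-letrec (bot r b)    = bot r b

  Sim-tree : ∀ {n d} {γ : GEnv n} {x S} → look γ x ≡ tree S → Sim d γ (var x) (label S)
  Sim-tree {d = zero}  eq = zero
  Sim-tree {d = suc d} eq = runs 0 (cong (runLook 0) eq) (tree (λ _ → refl))

  -- A variable that stands for a tree may be replaced by any term related to that tree, whereas a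
  -- letrec-bound variable must stay a variable. Its group is either untouched (`same`) or one into
  -- which the substitution has descended (`clo`).
  data TermSub {m n} (σ : Fin m → Expr n) (γ : GEnv m) (γ′ : GEnv n) : Set
  data TermLook {n} : Look → GEnv n → Expr n → Set

  data TermSub σ γ γ′ where
    sub : (∀ x → TermLook (look γ x) γ′ (σ x)) → TermSub σ γ γ′

  data TermLook where
    tree : ∀ {γ t S} → γ ⊢ t ∼ label S → TermLook (tree S) γ t
    same : ∀ {γ k m γ₀ i x} {bs : Fin (suc k) → Expr (suc k + m)} →
           look γ x ≡ clo bs γ₀ i → TermLook (clo bs γ₀ i) γ (var x)
    clo  : ∀ {γ k l m γ₀ γ₀′ i x} {bs : Fin (suc k) → Expr (suc k + m)} (σ : Fin m → Expr l) →
           look γ x ≡ clo (subst (liftSub (suc k) σ) ∘ bs) γ₀′ i → TermSub σ γ₀ γ₀′ →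
           TermLook (clo bs γ₀ i) γ (var x)

  TermLook-ren : ∀ {m n l} {γ : GEnv m} {γ′ : GEnv n} {t} (ρ : Fin m → Fin n) →
                 (∀ x → look γ′ (ρ x) ≡ look γ x) → TermLook l γ t → TermLook l γ′ (rename ρ t)
  TermLook-ren {γ = γ} ρ eq (tree m) = tree λ d →
    Sim-ren d ρ (ren λ x → ≡.subst (RenLook (look γ x)) (sym (eq x)) same) (m d)
  TermLook-ren ρ eq (same {x = x} e)    = same (trans (eq x) e)
  TermLook-ren ρ eq (clo {x = x} σ e s) = clo σ (trans (eq x) e) s

  TermLook-renEnv : ∀ {n l} {γ : GEnv n} {t} ρ →
                    TermLook l γ t → TermLook (renLook ρ l) (renEnv ρ γ) t
  TermLook-renEnv ρ (tree {S = S} m) = tree (∼-renEnv ρ S m)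
  TermLook-renEnv ρ (same {γ = γ} {x = x} e) =
    same (trans (look-renEnv ρ γ x) (cong (renLook ρ) e))
  TermLook-renEnv ρ (clo {γ = γ} {γ₀ = γ₀} {x = x} σ e (sub s)) =
    clo σ (trans (look-renEnv ρ γ x) (cong (renLook ρ) e)) (sub λ y →
      ≡.subst (λ l → TermLook l _ _) (sym (look-renEnv ρ γ₀ y)) (TermLook-renEnv ρ (s y)))

  TermSub-rec : ∀ {k m n} (σ : Fin m → Expr n) {γ γ′} (bs : Fin (suc k) → Expr (suc k + m)) →
                TermSub σ γ γ′ →
                TermSub (liftSub (suc k) σ) (rec bs γ) (rec (subst (liftSub (suc k) σ) ∘ bs) γ′)
  TermSub-rec {k} {n = n} σ {γ} {γ′} bs (sub s) = sub go
    where
    bs′ = subst (liftSub (suc k) σ) ∘ bs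
    inner′ : ∀ i → look (rec bs′ γ′) (i ↑ˡ n) ≡ clo bs′ γ′ i
    inner′ i rewrite splitAt-↑ˡ (suc k) i n = refl
    outer : ∀ y → look (rec bs′ γ′) (suc k ↑ʳ y) ≡ look γ′ y
    outer y rewrite splitAt-↑ʳ (suc k) n y = refl
    go : ∀ x → TermLook (look (rec bs γ) x) (rec bs′ γ′) (liftSub (suc k) σ x)
    go x with splitAt (suc k) x
    ... | inj₁ i = clo σ (inner′ i) (sub s)
    ... | inj₂ y = TermLook-ren (suc k ↑ʳ_) outer (s y)

  TermSub-under : ∀ k {m n} (σ : Fin m → Expr n) {γ γ′} →
                  TermSub σ γ γ′ → TermSub (liftSub k σ) (underᵍ k γ) (underᵍ k γ′)
  TermSub-under k {n = n} σ {γ} {γ′} (sub s) = sub go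
    where
    bound′ : ∀ i → look (underᵍ k γ′) (i ↑ˡ n) ≡ tree (varᵗ (toℕ i))
    bound′ i rewrite splitAt-↑ˡ k i n = refl
    outer : ∀ y → look (underᵍ k γ′) (k ↑ʳ y) ≡ look (renEnv (k +_) γ′) y
    outer y rewrite splitAt-↑ʳ k n y = refl
    go : ∀ x → TermLook (look (underᵍ k γ) x) (underᵍ k γ′) (liftSub k σ x)
    go x with splitAt k x
    ... | inj₁ i = tree λ d → Sim-tree (bound′ i)
    ... | inj₂ y rewrite look-renEnv (k +_) γ y =
      TermLook-ren (k ↑ʳ_) outer (TermLook-renEnv (k +_) (s y))

  -- A walk that runs out of fuel has not met a variable standing for a tree, so no inserted term
  -- has come into play and the substituted walk makes the same moves.
  run-subst-nothing : ∀ h {m n} (σ : Fin m → Expr n) {γ γ′} s → TermSub σ γ γ′ →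
                      run h γ s ≡ nothing → run h γ′ (subst σ s) ≡ nothing
  runLook-subst-nothing : ∀ h {n l} {γ : GEnv n} {t} → TermLook l γ t →
                          runLook h l ≡ nothing → run h γ t ≡ nothing

  run-subst-nothing h σ (var x) (sub s) r = runLook-subst-nothing h (s x) r
  run-subst-nothing h σ (letrec bs t) s r =
    run-subst-nothing h _ t (TermSub-rec σ bs s) r

  runLook-subst-nothing h (same e) r = trans (cong (runLook h) e) r
  runLook-subst-nothing zero (clo σ e s) r = cong (runLook 0) e
  runLook-subst-nothing (suc h) (clo {i = i} {bs = bs} σ e s) r =
    trans (cong (runLook (suc h)) e) (run-subst-nothing h _ (bs i) (TermSub-rec σ bs s) r)

  -- The walk from `s` is followed by recursion on its fuel. At a node the depth drops. At a
  -- variable standing for a tree the inserted term takes over with a walk of its own; this is why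
  -- `TermLook` asks for similarity at all depths.
  Sim-subst : ∀ d {m n} (σ : Fin m → Expr n) {γ γ′ s S} → TermSub σ γ γ′ →
              Sim d γ s S → Sim d γ′ (subst σ s) S
  Sim-subst-run : ∀ d h {m n} (σ : Fin m → Expr n) {γ γ′} s {H S} → TermSub σ γ γ′ →
                  run h γ s ≡ just H → Match d H S → Sim (suc d) γ′ (subst σ s) S
  Sim-subst-look : ∀ d h {n l} {γ : GEnv n} {t H S} → TermLook l γ t →
                   runLook h l ≡ just H → Match d H S → Sim (suc d) γ t S

  Sim-subst zero    σ s m = zero
  Sim-subst (suc d) σ {s = t} s (runs h r m) = Sim-subst-run d h σ t s r m
  Sim-subst (suc d) σ {s = t} s (bot r b) =
    bot (λ h → run-subst-nothing h σ t s (r h)) b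

  Sim-subst-run d h σ (var x) (sub s) r m = Sim-subst-look d h (s x) r m
  Sim-subst-run d h σ (letrec bs t) s r m =
    Sim-letrec (Sim-subst-run d h _ t (TermSub-rec σ bs s) r m)
  Sim-subst-run d h σ (app t u) s refl (app e m n) =
    runs h refl (app e (Sim-subst d σ s m) (Sim-subst d σ s n))
  Sim-subst-run d h σ (lam t) s refl (lam e m) =
    runs h refl (lam e (Sim-subst d _ (TermSub-under 1 σ s) m))
  Sim-subst-run d h σ (con T c ts) s refl (con e ms) =
    runs h refl (con e (λ j → Sim-subst d σ s (ms j)))
  Sim-subst-run d h σ (seq t u) s refl (seq e m n) =
    runs h refl (seq e (Sim-subst d σ s m) (Sim-subst d σ s n))
  Sim-subst-run d h σ (case T t as) s refl (case e m es ms) =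
    runs h refl (case e (Sim-subst d σ s m) es
                        (λ c → Sim-subst d _ (TermSub-under (ar T c) σ s) (ms c)))

  Sim-subst-look d h (tree m) refl (tree e) = Sim-resp (λ p → sym (e p)) (m (suc d))
  Sim-subst-look d h (same e) r m = runs h (trans (cong (runLook h) e) r) m
  Sim-subst-look d (suc h) (clo {i = i} {bs = bs} σ e s) r m =
    Sim-enter e (Sim-subst-run d h _ (bs i) (TermSub-rec σ bs s) r m)

  TermSub-inst : ∀ {k n} {γ : GEnv n} {ts : Fin k → Expr n} {Ss : Fin k → InfExpr} →
                 (∀ i → γ ⊢ ts i ∼ label (Ss i)) →
                 TermSub ([ ts , var ] ∘ splitAt k) (ext Ss γ) γ
  TermSub-inst {k} {γ = γ} {ts} {Ss} ms = sub go
    where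
    go : ∀ x → TermLook (look (ext Ss γ) x) γ ([ ts , var ] (splitAt k x))
    go x with splitAt k x
    ... | inj₁ i = tree (ms i)
    ... | inj₂ y with look γ y in eq
    ...   | tree S     = tree λ d → Sim-tree eq
    ...   | clo bs _ i = same eq

  SubEnv-lower : ∀ k {τ} → (∀ x → τ (k + x) ≈ varᵗ x) → ∀ {n} (γ : GEnv n) →
                 SubEnv τ (renEnv (k +_) γ) γ
  SubEnv-lower k {τ} eq = go
    where
    lower : ∀ S → S ≈ subᵗ τ (renᵗ (k +_) S)
    lower S p = sym (trans (sub-ren τ (k +_) (label S) p) (sub-id eq S p))
    go : ∀ {n} (γ : GEnv n) → SubEnv τ (renEnv (k +_) γ) γ
    go (base Ss)  = sub λ x → tree (lower (Ss x))
    go (ext Ss γ) = SubEnv-ext (λ i → lower (Ss i)) (go γ)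
    go (rec bs γ) = SubEnv-rec bs (go γ)

  -- Two stages: `Sim-sub` lets the `k` bound variables stand for `Ss` and cancels the shift that
  -- `underᵍ` applied to `γ`; then `Sim-subst` puts the terms `ts` in their place.
  ∼-inst : ∀ {k n} {γ : GEnv n} {s S} {ts : Fin k → Expr n} {Ss : Fin k → InfExpr} →
           underᵍ k γ ⊢ s ∼ label S → (∀ i → γ ⊢ ts i ∼ label (Ss i)) →
           γ ⊢ s ⟨ ts ⟩ ∼ label (S ⟨ k ∣ Ss ⟩ᵗ)
  ∼-inst {k} {γ = γ} {Ss = Ss} m ms d =
    Sim-subst d _ (TermSub-inst {Ss = Ss} ms) (Sim-sub d τ (SubEnv-ext hit (SubEnv-lower k outer γ)) (m d))
    where
    τ : ℕ → InfExpr
    τ x = maybe′ Ss (varᵗ (x ∸ k)) (select k x)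
    hit : ∀ i → Ss i ≈ subᵗ τ (varᵗ (toℕ i))
    hit i p rewrite select-toℕ i = refl
    outer : ∀ x → τ (k + x) ≈ varᵗ x
    outer x p rewrite select-≥ (m≤m+n k x) | m+n∸m≡n k x = refl

  -- Inversion of the simulation

  -- Every depth brings a run of its own; by determinism they all stop at the same head.
  ∼-match : ∀ {n h H} {γ : GEnv n} {s S} →
            γ ⊢ s ∼ S → run h γ s ≡ just H → ∀ d → Match d H S
  ∼-match {h = h} {s = s} m r d with m (suc d)
  ... | runs h′ r′ m′ = ≡.subst (λ H → Match d H _) (run-det {h = h′} {h} s r′ r) m′
  ... | bot r′ _ with () ← trans (sym r) (r′ h)

  Match-app : ∀ {n} {γ : GEnv n} {s t S} → (∀ d → Match d (hd γ (app s t)) S) →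
              S [] ≡ just app × γ ⊢ s ∼ (S / 0) × γ ⊢ t ∼ (S / 1)
  Match-app m with m 0
  ... | app e _ _ = e , (λ d → case m d of λ { (app _ n _) → n })
                      , (λ d → case m d of λ { (app _ _ n) → n })

  Match-lam : ∀ {n} {γ : GEnv n} {s S} → (∀ d → Match d (hd γ (lam s)) S) →
              S [] ≡ just lam × underᵍ 1 γ ⊢ s ∼ (S / 0)
  Match-lam m with m 0
  ... | lam e _ = e , λ d → case m d of λ { (lam _ n) → n }

  Match-con : ∀ {n} {γ : GEnv n} {T c ss S} → (∀ d → Match d (hd γ (con T c ss)) S) →
              S [] ≡ just (con T c) × (∀ j → γ ⊢ ss j ∼ (S / toℕ j))
  Match-con m with m 0
  ... | con e _ = e , λ j d → case m d of λ { (con _ n) → n j }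

  Match-seq : ∀ {n} {γ : GEnv n} {s t S} → (∀ d → Match d (hd γ (seq s t)) S) →
              S [] ≡ just seq × γ ⊢ s ∼ (S / 0) × γ ⊢ t ∼ (S / 1)
  Match-seq m with m 0
  ... | seq e _ _ = e , (λ d → case m d of λ { (seq _ n _) → n })
                      , (λ d → case m d of λ { (seq _ _ n) → n })

  Match-case : ∀ {n} {γ : GEnv n} {T s as S} → (∀ d → Match d (hd γ (case T s as)) S) →
               S [] ≡ just (case T) × γ ⊢ s ∼ (S / 0) ×
               (∀ c → S (suc (toℕ c) ∷ []) ≡ just (alt T c) ×
                      underᵍ (ar T c) γ ⊢ as c ∼ (S / suc (toℕ c) / 0))
  Match-case m with m 0
  ... | case e _ es _ = e , (λ d → case m d of λ { (case _ n _ _) → n })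
                          , λ c → es c , λ d → case m d of λ { (case _ _ _ n) → n c }

  Sim-unletrec : ∀ {n k d} {γ : GEnv n} {bs : Fin (suc k) → Expr (suc k + n)} {t S} →
                 Sim d γ (letrec bs t) S → Sim d (rec bs γ) t S
  Sim-unletrec zero         = zero
  Sim-unletrec (runs h r m) = runs h r m
  Sim-unletrec (bot r b)    = bot r b

  Sim-leave : ∀ {n k m d} {γ : GEnv n} {x S i} {bs : Fin (suc k) → Expr (suc k + m)} {γ₀} →
              look γ x ≡ clo bs γ₀ i → Sim d γ (var x) S → Sim d (rec bs γ₀) (bs i) S
  Sim-leave eq zero               = zero
  -- Hitting `x` costs one unit of fuel, so a walk from `x` that stops had at least one.
  Sim-leave eq (runs zero r m)    with () ← trans (sym (cong (runLook 0) eq)) r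
  Sim-leave eq (runs (suc h) r m) = runs h (trans (sym (cong (runLook (suc h)) eq)) r) m
  Sim-leave eq (bot r b)          =
    bot (λ h → trans (sym (cong (runLook (suc h)) eq)) (r (suc h))) b

  -- Subtrees

  Conforming : Sort → Labelling → Set
  Conforming κ S = ∀ d → Conforms d κ S

  conforming-child : ∀ {κ S ℓ} → Conforming κ S → S [] ≡ just ℓ →
                     ∀ j → Conforming (childSort ℓ j) (S / toℕ j)
  conforming-child c e j d with c (suc d)
  ... | _ , r , _ , ok , _ with trans (sym e) r
  ... | refl = ok j

  -- Conformance is what makes the positions at and beyond the rank empty, as they are in `node`.
  node-η : ∀ {κ S ℓ} → Conforming κ S → S [] ≡ just ℓ → S ≐ node ℓ (λ j → S / toℕ j)
  node-η c e [] = e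
  node-η {S = S} {ℓ} c e (i ∷ p) with c 1
  ... | _ , r , _ , _ , out with trans (sym e) r
  ... | refl with i <? rank ℓ
  ...   | no  i≮r rewrite select-≥ (≮⇒≥ i≮r) = out i (≮⇒≥ i≮r) p
  ...   | yes i<r = ≡.subst (λ i → S (i ∷ p) ≡ node ℓ (λ j → S / toℕ j) (i ∷ p))
                            (toℕ-fromℕ< i<r) (hit (fromℕ< i<r))
    where
    hit : ∀ (j : Fin (rank ℓ)) → S (toℕ j ∷ p) ≡ node ℓ (λ j → S / toℕ j) (toℕ j ∷ p)
    hit j rewrite select-toℕ j = refl

  node-cong : ∀ ℓ {Ss Ts : Fin (rank ℓ) → Labelling} → (∀ j → Ss j ≐ Ts j) → node ℓ Ss ≐ node ℓ Ts
  node-cong ℓ eq []      = refl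
  node-cong ℓ eq (i ∷ p) with select (rank ℓ) i
  ... | just j  = eq j p
  ... | nothing = refl

  subtree : ∀ {S} → Conforming expr S → InfExpr
  subtree {S} c = record { label = S ; conforms = c }

  appᵗ-η : ∀ S → label S [] ≡ just app → ∃ λ S₁ → ∃ λ S₂ →
           label S₁ ≡ label S / 0 × label S₂ ≡ label S / 1 × S ≈ appᵗ S₁ S₂
  appᵗ-η S e = subtree (child zero) , subtree (child (suc zero)) , refl , refl , λ p →
    trans (node-η (conforms S) e p) (node-cong app (λ { zero p → refl ; (suc zero) p → refl }) p)
    where child = conforming-child (conforms S) e

  seqᵗ-η : ∀ S → label S [] ≡ just seq → ∃ λ S₁ → ∃ λ S₂ →
           label S₁ ≡ label S / 0 × label S₂ ≡ label S / 1 × S ≈ seqᵗ S₁ S₂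
  seqᵗ-η S e = subtree (child zero) , subtree (child (suc zero)) , refl , refl , λ p →
    trans (node-η (conforms S) e p) (node-cong seq (λ { zero p → refl ; (suc zero) p → refl }) p)
    where child = conforming-child (conforms S) e

  lamᵗ-η : ∀ S → label S [] ≡ just lam → ∃ λ S₁ → label S₁ ≡ label S / 0 × S ≈ lamᵗ S₁
  lamᵗ-η S e = subtree (child zero) , refl , λ p →
    trans (node-η (conforms S) e p) (node-cong lam (λ { zero p → refl }) p)
    where child = conforming-child (conforms S) e

  conᵗ-η : ∀ S {T c} → label S [] ≡ just (con T c) → ∃ λ Ss →
           (∀ j → label (Ss j) ≡ label S / toℕ j) × S ≈ conᵗ T c Ss
  conᵗ-η S e = (λ j → subtree (conforming-child (conforms S) e j)) , (λ j → refl) ,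
    node-η (conforms S) e

  caseᵗ-η : ∀ S {T} → label S [] ≡ just (case T) →
            (∀ c → label S (suc (toℕ c) ∷ []) ≡ just (alt T c)) → ∃ λ S₁ → ∃ λ Ss →
            label S₁ ≡ label S / 0 × (∀ c → label (Ss c) ≡ label S / suc (toℕ c) / 0) ×
            S ≈ caseᵗ T S₁ Ss
  caseᵗ-η S {T} e es = subtree (child zero) ,
    (λ c → subtree (conforming-child (child (suc c)) (es c) zero)) , refl , (λ c → refl) , λ p →
    trans (node-η (conforms S) e p)
          (node-cong (case T)
            (λ { zero p → refl
               ; (suc c) p → trans (node-η (child (suc c)) (es c) p)
                                   (node-cong (alt T c) (λ { zero p → refl }) p) }) p)
    where child = conforming-child (conforms S) e

  T-cong : ∀ R {S S′} → S ≈ S′ → R T[ S ] ≈ R T[ S′ ]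
  T-cong □             eq = eq
  T-cong (app R T)     eq = node-cong app λ { zero → T-cong R eq ; (suc zero) _ → refl }
  T-cong (seq R T)     eq = node-cong seq λ { zero → T-cong R eq ; (suc zero) _ → refl }
  T-cong (case T R Ss) eq = node-cong (case T) λ { zero → T-cong R eq ; (suc c) _ → refl }

  ∼-app : ∀ {n} {γ : GEnv n} {s t S T} → γ ⊢ s ∼ label S → γ ⊢ t ∼ label T →
          γ ⊢ app s t ∼ label (appᵗ S T)
  ∼-app m n zero    = zero
  ∼-app m n (suc d) = runs 0 refl (app refl (m d) (n d))

  ∼-seq : ∀ {n} {γ : GEnv n} {s t S T} → γ ⊢ s ∼ label S → γ ⊢ t ∼ label T →
          γ ⊢ seq s t ∼ label (seqᵗ S T)
  ∼-seq m n zero    = zero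
  ∼-seq m n (suc d) = runs 0 refl (seq refl (m d) (n d))

  caseᵗ-alt : ∀ T S Ss c → label (caseᵗ T S Ss) / suc (toℕ c) / 0 ≐ label (Ss c)
  caseᵗ-alt T S Ss c p rewrite select-toℕ c = refl

  conᵗ-arg : ∀ T c Ss j → label (conᵗ T c Ss) / toℕ j ≐ label (Ss j)
  conᵗ-arg T c Ss j p rewrite select-toℕ j = refl

  ∼-case : ∀ {n} {γ : GEnv n} {T s as S Ss} → γ ⊢ s ∼ label S →
           (∀ c → underᵍ (ar T c) γ ⊢ as c ∼ label (Ss c)) →
           γ ⊢ case T s as ∼ label (caseᵗ T S Ss)
  ∼-case m ms zero    = zero
  ∼-case {T = T} {S = S} {Ss} m ms (suc d) = runs 0 refl
    (case refl (m d) lab (λ c → Sim-resp (λ p → sym (caseᵗ-alt T S Ss c p)) (ms c d)))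
    where
    lab : ∀ c → label (caseᵗ T S Ss) (suc (toℕ c) ∷ []) ≡ just (alt T c)
    lab c rewrite select-toℕ c = refl

  ∼-resp : ∀ {n} {γ : GEnv n} {s S S′} → S ≐ S′ → γ ⊢ s ∼ S → γ ⊢ s ∼ S′
  ∼-resp eq m d = Sim-resp eq (m d)

  ∼-label : ∀ {n} {γ : GEnv n} {s S S′} → S′ ≡ S → γ ⊢ s ∼ S → γ ⊢ s ∼ S′
  ∼-label refl m = m

  -- From name reduction to tree reduction

  record Split {n} (γ : GEnv n) (A : ACtx n) (e : Expr n) (S : InfExpr) : Set where
    constructor split
    field
      ctx   : TreeCtx
      focus : InfExpr
      decomposes : S ≈ ctx T[ focus ]
      focused    : γ ⊢ e ∼ label focus
      plugging   : ∀ {e′} S′ → γ ⊢ e′ ∼ label S′ → γ ⊢ A A[ e′ ] ∼ label (ctx T[ S′ ])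

  -- The path to the hole of an A-context crosses neither binders nor letrecs, so its nodes reappear
  -- in the tree and the hole keeps the environment `γ`. The field `plugging` admits any related
  -- pair, so that one decomposition serves redex and contractum.
  splitCtx : ∀ {n} {γ : GEnv n} A {e} S → γ ⊢ A A[ e ] ∼ label S → Split γ A e S
  splitCtx □ S m = split □ S (λ _ → refl) m (λ _ m → m)
  splitCtx (app A t) S m with Match-app (∼-match {h = 0} m refl)
  ... | e , m₁ , m₂ with appᵗ-η S e
  ... | S₁ , S₂ , l₁ , l₂ , η with splitCtx A S₁ (∼-label l₁ m₁)
  ... | split R S₀ dec foc plug = split (app R S₂) S₀
    (λ p → trans (η p) (node-cong app (λ { zero → dec ; (suc zero) _ → refl }) p)) foc
    (λ S′ m → ∼-app {S = R T[ S′ ]} {S₂} (plug S′ m) (∼-label l₂ m₂))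
  splitCtx (seq A t) S m with Match-seq (∼-match {h = 0} m refl)
  ... | e , m₁ , m₂ with seqᵗ-η S e
  ... | S₁ , S₂ , l₁ , l₂ , η with splitCtx A S₁ (∼-label l₁ m₁)
  ... | split R S₀ dec foc plug = split (seq R S₂) S₀
    (λ p → trans (η p) (node-cong seq (λ { zero → dec ; (suc zero) _ → refl }) p)) foc
    (λ S′ m → ∼-seq {S = R T[ S′ ]} {S₂} (plug S′ m) (∼-label l₂ m₂))
  splitCtx (case T A as) S m with Match-case (∼-match {h = 0} m refl)
  ... | e , m₁ , ms with caseᵗ-η S e (proj₁ ∘ ms)
  ... | S₁ , Ss , l₁ , ls , η with splitCtx A S₁ (∼-label l₁ m₁)
  ... | split R S₀ dec foc plug = split (case T R Ss) S₀
    (λ p → trans (η p) (node-cong (case T) (λ { zero → dec ; (suc c) _ → refl }) p)) foc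
    (λ S′ m → ∼-case {S = R T[ S′ ]} {Ss} (plug S′ m) (λ c → ∼-label (ls c) (proj₂ (ms c))))

  envL : ∀ {n m} → GEnv n → LCtx n m → GEnv m
  envL γ □             = γ
  envL γ (letrec bs L) = envL (rec bs γ) L

  ∼-plugL : ∀ {n m} {γ : GEnv n} (L : LCtx n m) {e S} → envL γ L ⊢ e ∼ S → γ ⊢ L L[ e ] ∼ S
  ∼-plugL □             m = m
  ∼-plugL (letrec bs L) m = λ d → Sim-letrec (∼-plugL L m d)

  ∼-unplugL : ∀ {n m} {γ : GEnv n} (L : LCtx n m) {e S} → γ ⊢ L L[ e ] ∼ S → envL γ L ⊢ e ∼ S
  ∼-unplugL □             m = m
  ∼-unplugL (letrec bs L) m = ∼-unplugL L (λ d → Sim-unletrec (m d))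

  look-inL : ∀ {n m} (γ : GEnv n) (L : LCtx n m) x → look (envL γ L) (inL L x) ≡ look γ x
  look-inL γ □ x = refl
  look-inL {n} γ (letrec {k} bs L) x =
    trans (look-inL (rec bs γ) L (suc k ↑ʳ x)) outer
    where
    outer : look (rec bs γ) (suc k ↑ʳ x) ≡ look γ x
    outer rewrite splitAt-↑ʳ (suc k) n x = refl

  Sim-inL : ∀ {n m d} {γ : GEnv n} (L : LCtx n m) {e S} →
            Sim d γ e S → Sim d (envL γ L) (rename (inL L) e) S
  Sim-inL {γ = γ} L = Sim-ren _ (inL L)
    (ren λ x → ≡.subst (RenLook (look γ x)) (sym (look-inL γ L x)) same)

  Forward : ∀ {n} → GEnv n → Expr n → InfExpr → Set
  Forward γ s′ S = ∃ λ S′ → S ⟶tree* S′ × γ ⊢ s′ ∼ label S′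

  forward-silent : ∀ {n m} {γ : GEnv n} ((L , A) : RCtx n m) {e e′} S →
                   (∀ {S} → envL γ L ⊢ e ∼ label S → envL γ L ⊢ e′ ∼ label S) →
                   γ ⊢ (L , A) R[ e ] ∼ label S → Forward γ ((L , A) R[ e′ ]) S
  forward-silent (L , A) S f m with splitCtx A S (∼-unplugL L m)
  ... | split R S₁ dec foc plug = S , ε , ∼-plugL L
    (∼-resp (λ p → sym (dec p)) (plug S₁ (f {S₁} foc)))

  Contracts : ∀ {n} → GEnv n → Expr n → InfExpr → Set
  Contracts γ e′ S = ∃ λ S₁ → ∃ λ S₂ → S ≈ S₁ × S₁ ↦ S₂ × γ ⊢ e′ ∼ label S₂

  forward-step : ∀ {n m} {γ : GEnv n} ((L , A) : RCtx n m) {e e′} S →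
                 (∀ S → envL γ L ⊢ e ∼ label S → Contracts (envL γ L) e′ S) →
                 γ ⊢ (L , A) R[ e ] ∼ label S → Forward γ ((L , A) R[ e′ ]) S
  forward-step (L , A) S f m with splitCtx A S (∼-unplugL L m)
  ... | split R S₀ dec foc plug with f S₀ foc
  ... | S₁ , S₂ , eq , red , m₂ = R T[ S₂ ] ,
    step R (λ p → trans (dec p) (T-cong R eq p)) red (λ _ → refl) ◅ ε ,
    ∼-plugL L (plug S₂ m₂)

  Value⇒Answer : ∀ {n} {γ : GEnv n} {v} → Value v → ∀ S → γ ⊢ v ∼ label S → Answer S
  Value⇒Answer lam S m with lamᵗ-η S (proj₁ (Match-lam {S = label S} (∼-match {h = 0} m refl)))
  ... | S′ , _ , η = lam {S′ = S′} η
  Value⇒Answer con S m with conᵗ-η S (proj₁ (Match-con {S = label S} (∼-match {h = 0} m refl)))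
  ... | Ss , _ , η = con {Ss = Ss} η

  contract-beta : ∀ {n} {γ : GEnv n} {s t} S → γ ⊢ app (lam s) t ∼ label S →
                  Contracts γ (s ⟨ const t ⟩) S
  contract-beta {s = s} S m with Match-app (∼-match {h = 0} m refl)
  ... | e , m₁ , m₂ with appᵗ-η S e
  ... | S₁ , S₂ , l₁ , l₂ , η with Match-lam (∼-match {h = 0} (∼-label l₁ m₁) refl)
  ... | e′ , m₀ with lamᵗ-η S₁ e′
  ... | S₀ , l₀ , η′ = appᵗ (lamᵗ S₀) S₂ , S₀ ⟨ 1 ∣ const S₂ ⟩ᵗ ,
    (λ p → trans (η p) (node-cong app (λ { zero → η′ ; (suc zero) _ → refl }) p)) , beta ,
    ∼-inst {s = s} {S₀} (∼-label l₀ m₀) (λ _ → ∼-label l₂ m₂)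

  contract-seq : ∀ {n} {γ : GEnv n} {v s} → Value v → ∀ S → γ ⊢ seq v s ∼ label S →
                 Contracts γ s S
  contract-seq val S m with Match-seq (∼-match {h = 0} m refl)
  ... | e , m₁ , m₂ with seqᵗ-η S e
  ... | S₁ , S₂ , l₁ , l₂ , η = seqᵗ S₁ S₂ , S₂ , η ,
    seq (Value⇒Answer val S₁ (∼-label l₁ m₁)) , ∼-label l₂ m₂

  contract-case : ∀ {n} {γ : GEnv n} {T c ss as} S → γ ⊢ case T (con T c ss) as ∼ label S →
                  Contracts γ (as c ⟨ ss ⟩) S
  contract-case {T = T} {c} {as = as} S m with Match-case (∼-match {h = 0} m refl)
  ... | e , m₁ , ms with caseᵗ-η S e (proj₁ ∘ ms)
  ... | S₁ , Ss , l₁ , ls , η with Match-con (∼-match {h = 0} (∼-label l₁ m₁) refl)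
  ... | e′ , ms₀ with conᵗ-η S₁ e′
  ... | Ts , ls₀ , η′ = caseᵗ T (conᵗ T c Ts) Ss , Ss c ⟨ ar T c ∣ Ts ⟩ᵗ ,
    (λ p → trans (η p) (node-cong (case T) (λ { zero → η′ ; (suc c) _ → refl }) p)) , case ,
    ∼-inst {s = as c} {Ss c} (∼-label (ls c) (proj₂ (ms c))) (λ j → ∼-label (ls₀ j) (ms₀ j))

  -- Passing a letrec costs no fuel, so both sides stop at the application at once. For `s` the
  -- group merely moves from the term to the environment, and the weakened `t` cannot refer to it.
  ∼-lapp : ∀ {n k} {γ : GEnv n} {bs : Fin (suc k) → Expr (suc k + n)} {s t S} →
           γ ⊢ app (letrec bs s) t ∼ S → γ ⊢ letrec bs (app s (weaken (suc k) t)) ∼ S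
  ∼-lapp m zero = zero
  ∼-lapp {bs = bs} m (suc d) with Match-app (∼-match {h = 0} m refl)
  ... | e , m₁ , m₂ = runs 0 refl
    (app e (Sim-unletrec (m₁ d)) (Sim-ren d _ (Ren-weaken-rec bs) (m₂ d)))

  ∼-lseq : ∀ {n k} {γ : GEnv n} {bs : Fin (suc k) → Expr (suc k + n)} {s t S} →
           γ ⊢ seq (letrec bs s) t ∼ S → γ ⊢ letrec bs (seq s (weaken (suc k) t)) ∼ S
  ∼-lseq m zero = zero
  ∼-lseq {bs = bs} m (suc d) with Match-seq (∼-match {h = 0} m refl)
  ... | e , m₁ , m₂ = runs 0 refl
    (seq e (Sim-unletrec (m₁ d)) (Sim-ren d _ (Ren-weaken-rec bs) (m₂ d)))

  ∼-lcase : ∀ {n k} {γ : GEnv n} {bs : Fin (suc k) → Expr (suc k + n)} {s T as S} →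
            γ ⊢ case T (letrec bs s) as ∼ S →
            γ ⊢ letrec bs (case T s λ c → rename (liftRen (ar T c) (suc k ↑ʳ_)) (as c)) ∼ S
  ∼-lcase m zero = zero
  ∼-lcase {bs = bs} {T = T} m (suc d) with Match-case (∼-match {h = 0} m refl)
  ... | e , m₁ , ms = runs 0 refl
    (case e (Sim-unletrec (m₁ d)) (proj₁ ∘ ms)
      (λ c → Sim-ren d _ (Ren-under (ar T c) _ (Ren-weaken-rec bs)) (proj₂ (ms c) d)))

  look-bound : ∀ {n k} (γ : GEnv n) (bs : Fin (suc k) → Expr (suc k + n)) i →
               look (rec bs γ) (i ↑ˡ n) ≡ clo bs γ i
  look-bound {n} {k} γ bs i rewrite splitAt-↑ˡ (suc k) i n = refl

  forward : ∀ {n} {γ : GEnv n} {s s′} S → s ⟶name s′ → γ ⊢ s ∼ label S → Forward γ s′ S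
  forward S (beta R {s})  m = forward-step R S contract-beta m
  forward S (seq R v) m = forward-step R S (contract-seq v) m
  forward S (case R {alts = as}) m = forward-step R S (contract-case {as = as}) m
  forward S (lapp R)  m = forward-silent R S ∼-lapp m
  forward S (lcase R) m = forward-silent R S ∼-lcase m
  forward S (lseq R)  m = forward-silent R S ∼-lseq m
  forward {γ = γ} S (gcp L bs L′ A i) m
    -- The walk from the variable leads to its binding anyway, so `Sim-leave` relates the binding to
    -- the same tree; `Sim-inL` carries this into the scope below `L′`.
    with forward-silent (L′ , A) {e′ = rename (inL L′) (bs i)} S
           (λ m d → Sim-inL L′ (Sim-leave hit (m d))) (λ d → Sim-unletrec (∼-unplugL L m d))
    where
    hit : look (envL (rec bs (envL γ L)) L′) (inL L′ (i ↑ˡ _)) ≡ clo bs (envL γ L) i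
    hit = trans (look-inL (rec bs (envL γ L)) L′ (i ↑ˡ _)) (look-bound (envL γ L) bs i)
  ... | S′ , reds , m′ = S′ , reds , ∼-plugL L (λ d → Sim-letrec (m′ d))

  forward* : ∀ {n} {γ : GEnv n} {s s′} S → s ⟶name* s′ → γ ⊢ s ∼ label S → Forward γ s′ S
  forward* S ε       m = S , ε , m
  forward* S (r ◅ rs) m with forward S r m
  ... | S₁ , reds₁ , m₁ with forward* S₁ rs m₁
  ... | S₂ , reds₂ , m₂ = S₂ , reds₁ ◅◅ reds₂ , m₂

  name⇒tree : ∀ {n} {γ : GEnv n} {s} S → γ ⊢ s ∼ label S → s ↓name → S ↓tree
  name⇒tree S m (_ , reds , whnf L v) with forward* S reds m
  ... | S′ , treds , m′ = S′ , treds , Value⇒Answer v S′ (∼-unplugL L m′)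

  -- The letrec-unfolding simulates the expression

  data HeadOf {n} : Label → Expr n → Set where
    app  : ∀ {s t} → HeadOf app (app s t)
    lam  : ∀ {s} → HeadOf lam (lam s)
    con  : ∀ {T c ss} → HeadOf (con T c) (con T c ss)
    seq  : ∀ {s t} → HeadOf seq (seq s t)
    case : ∀ {T s as} → HeadOf (case T) (case T s as)

  data EnvSim : ∀ {n} → Env n → GEnv n → Set where
    free  : ∀ {n d} {Ss : Fin n → InfExpr} → (∀ x → Ss x ≈ varᵗ (d + toℕ x)) →
            EnvSim (free d) (base Ss)
    bound : ∀ {k n d} {Ss : Fin k → InfExpr} {η : Env n} {γ} →
            (∀ i → Ss i ≈ varᵗ (d + toℕ i)) → EnvSim η γ → EnvSim (bound d η) (ext Ss γ)
    rec   : ∀ {k n} {bs : Fin (suc k) → Expr (suc k + n)} {η γ} →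
            EnvSim η γ → EnvSim (rec bs η) (rec bs γ)

  EnvSim-shift : ∀ k {n} {η : Env n} {γ} → EnvSim η γ → EnvSim (shift k η) (renEnv (k +_) γ)
  EnvSim-shift k = go
    where
    up : ∀ d x {S} → S ≈ varᵗ (d + x) → renᵗ (k +_) S ≈ varᵗ (k + d + x)
    up d x eq p rewrite +-assoc k d x =
      trans (ren-congʳ (k +_) _ _ eq p) (ren-var (k +_) (d + x) p)
    go : ∀ {n} {η : Env n} {γ} → EnvSim η γ → EnvSim (shift k η) (renEnv (k +_) γ)
    go (free {d = d} {Ss} eq)    = free λ x → up d (toℕ x) {Ss x} (eq x)
    go (bound {d = d} {Ss} eq e) = bound (λ i → up d (toℕ i) {Ss i} (eq i)) (go e)
    go (rec e)                   = rec (go e)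

  EnvSim-under : ∀ k {n} {η : Env n} {γ} → EnvSim η γ → EnvSim (under k η) (underᵍ k γ)
  EnvSim-under k e = bound (λ _ _ → refl) (EnvSim-shift k e)

  -- At a node `walk` ignores its `hit` argument, so `walk η hit w` with an arbitrary `hit`
  -- describes the outcome without listing the children for each kind of node.
  data Agree : Head → Stop expr → Set where
    tree : ∀ {S x st} → S ≈ varᵗ x → proj₁ st ≡ var x → Agree (tree S) st
    hd   : ∀ {n ℓ} {η : Env n} {γ w} hit → HeadOf ℓ w → EnvSim η γ →
           Agree (hd γ w) (walk η hit w)

  Complete : ∀ {n} → ℕ → GEnv n → (Fin n → Stop expr) → Set
  Complete h γ hit = ∀ x {H} → runLook h (look γ x) ≡ just H → Agree H (hit x)

  -- The measure behind the counter of `enter`: while `unmarked V ≤ u` holds, `u` can be 0 only if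
  -- every variable of the group is marked.
  unmarked : ∀ {n} → Vec Bool n → ℕ
  unmarked []          = 0
  unmarked (true  ∷ V) = unmarked V
  unmarked (false ∷ V) = suc (unmarked V)

  unmarked-none : ∀ {n} (V : Vec Bool n) → unmarked V ≤ 0 → ∀ i → lookup V i ≡ true
  unmarked-none (true ∷ V) V≤0 zero    = refl
  unmarked-none (true ∷ V) V≤0 (suc i) = unmarked-none V V≤0 i

  unmarked-mark : ∀ {n} (V : Vec Bool n) i → lookup V i ≡ false →
                  suc (unmarked (V [ i ]≔ true)) ≡ unmarked V
  unmarked-mark (false ∷ V) zero    eq = refl
  unmarked-mark (true  ∷ V) (suc i) eq = unmarked-mark V i eq
  unmarked-mark (false ∷ V) (suc i) eq = cong suc (unmarked-mark V i eq)

  unmarked-replicate : ∀ n → unmarked (replicate n false) ≡ n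
  unmarked-replicate zero    = refl
  unmarked-replicate (suc n) = cong suc (unmarked-replicate n)

  runLook-nothing : ∀ {h h′} l → h ≤ h′ → runLook h′ l ≡ nothing → runLook h l ≡ nothing
  runLook-nothing {h} l h≤ r with runLook h l in r′
  ... | nothing = refl
  ... | just _ with () ← trans (sym r) (runLook-mono l h≤ r′)

  Complete-mono : ∀ h {n} (γ : GEnv n) {hit} → Complete (suc h) γ hit → Complete h γ hit
  Complete-mono h γ c x r = c x (runLook-mono (look γ x) (n≤1+n _) r)

  walk-complete : ∀ h {n} {η : Env n} {γ hit H} s → EnvSim η γ → Complete h γ hit →
                  run h γ s ≡ just H → Agree H (walk η hit s)

  -- The marks are sound as long as a marked variable does not stop within
  -- the current fuel; taking the fuel minimal for the variable being
  -- entered keeps them so when it is marked.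
  enter-complete : ∀ h {k n} {bs : Fin (suc k) → Expr (suc k + n)} {η γ hit H} →
                   EnvSim η γ → Complete h γ hit → ∀ u V →
                   (∀ j → lookup V j ≡ true → runLook h (clo bs γ j) ≡ nothing) →
                   unmarked V ≤ u → ∀ i → runLook h (clo bs γ i) ≡ just H →
                   Agree H (enter bs η hit u V i)
  enter-complete-minimal :
    ∀ h {k n} {bs : Fin (suc k) → Expr (suc k + n)} {η γ hit H} →
    EnvSim η γ → Complete (suc h) γ hit → ∀ u V →
    (∀ j → lookup V j ≡ true → runLook (suc h) (clo bs γ j) ≡ nothing) →
    unmarked V ≤ u → ∀ i → runLook (suc h) (clo bs γ i) ≡ just H →
    runLook h (clo bs γ i) ≡ nothing → Agree H (enter bs η hit u V i)
  Complete-rec : ∀ h {k n} (bs : Fin (suc k) → Expr (suc k + n)) {η γ hit} →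
                 EnvSim η γ → Complete h γ hit → ∀ u V →
                 (∀ j → lookup V j ≡ true → runLook h (clo bs γ j) ≡ nothing) →
                 unmarked V ≤ u →
                 Complete h (rec bs γ) ([ enter bs η hit u V , hit ] ∘ splitAt (suc k))
  Complete-rec₀ : ∀ h {k n} (bs : Fin (suc k) → Expr (suc k + n)) {η γ hit} →
                  EnvSim η γ → Complete h γ hit →
                  Complete h (rec bs γ)
                    ([ enter bs η hit (suc k) (replicate (suc k) false) , hit ] ∘ splitAt (suc k))

  walk-complete h (var x)       e c r    = c x r
  walk-complete h (letrec bs t) e c r    = walk-complete h t (rec e) (Complete-rec₀ h bs e c) r
  walk-complete h {hit = hit} (app s t) e c refl = hd hit app e
  walk-complete h {hit = hit} (lam s) e c refl = hd hit lam e
  walk-complete h {hit = hit} (con T c′ ss) e c refl = hd hit con e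
  walk-complete h {hit = hit} (seq s t) e c refl = hd hit seq e
  walk-complete h {hit = hit} (case T s as) e c refl = hd hit case e

  Complete-rec h {k} bs e c u V marks V≤u x r with splitAt (suc k) x
  ... | inj₁ i = enter-complete h e c u V marks V≤u i r
  ... | inj₂ y = c y r

  Complete-rec₀ h {k} bs e c = Complete-rec h bs e c (suc k) _
    (λ j eq → case trans (sym eq) (lookup-replicate j false) of λ ())
    (≤-reflexive (unmarked-replicate (suc k)))

  enter-complete (suc h) {bs = bs} {γ = γ} e c u V marks V≤u i r
    with runLook h (clo bs γ i) in r′
  ... | nothing = enter-complete-minimal h e c u V marks V≤u i r r′
  ... | just H
    rewrite just-injective (trans (sym r) (runLook-mono (clo bs γ i) (n≤1+n h) r′)) =
    enter-complete h e (Complete-mono h γ c) u V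
      (λ j eq → runLook-nothing (clo bs γ j) (n≤1+n h) (marks j eq)) V≤u i r′

  -- All variables are marked here, `i` among them, and a marked variable does not stop with this
  -- fuel, contrary to `r`.
  enter-complete-minimal h e c zero V marks V≤u i r r′
    with () ← trans (sym r) (marks i (unmarked-none V V≤u i))
  enter-complete-minimal h {bs = bs} {γ = γ} e c (suc u) V marks V≤u i r r′
    with lookup V i in eq
  ... | true with () ← trans (sym r) (marks i eq)
  ... | false = walk-complete h (bs i) (rec e)
    (Complete-rec h bs e (Complete-mono h γ c) u (V [ i ]≔ true) marks′
      (s≤s⁻¹ (≤-trans (≤-reflexive (unmarked-mark V i eq)) V≤u))) r
    where
    marks′ : ∀ j → lookup (V [ i ]≔ true) j ≡ true → runLook h (clo bs γ j) ≡ nothing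
    marks′ j eq′ with j ≟ i
    -- The new mark on `i` is justified by the minimality of its fuel: with one unit less it does
    -- not stop.
    ... | yes refl = r′
    ... | no j≢i   = runLook-nothing (clo bs γ j) (n≤1+n h)
                       (marks j (trans (sym (lookup∘update′ j≢i V true)) eq′))

  Complete₀ : ∀ h {n} {η : Env n} {γ} → EnvSim η γ → Complete h γ (hit₀ η)
  Complete₀ h (free eq) x refl = tree (eq x) refl
  Complete₀ h (bound {k} eq e) x r with splitAt k x
  Complete₀ h (bound eq e) x refl | inj₁ i = tree (eq i) refl
  Complete₀ h (bound eq e) x r    | inj₂ y = Complete₀ h e y r
  Complete₀ h (rec {bs = bs} e) = Complete-rec₀ h bs e (Complete₀ h e)

  -- Outcomes of the marked walk other than Bot come from walks that stop

  Stops : Stop expr → (ℕ → Maybe Head) → Set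
  Stops st outcome = proj₁ st ≡ bot ⊎ ∃ λ h → ∃ λ H → outcome h ≡ just H

  HitStops : ∀ {n} → GEnv n → (Fin n → Stop expr) → Set
  HitStops γ hit = ∀ x → Stops (hit x) (λ h → runLook h (look γ x))

  -- Makes the choice between `runs` and `bot` constructive: `walk` always terminates, and the fuel
  -- is assembled along its own recursion, one unit per variable entered.
  walk-stops  : ∀ {n η} {γ : GEnv n} {hit} s → HitStops γ hit →
                Stops (walk η hit s) (λ h → run h γ s)
  enter-stops : ∀ {k n η γ hit} (bs : Fin (suc k) → Expr (suc k + n)) → HitStops γ hit →
                ∀ u V i → Stops (enter bs η hit u V i) (λ h → runLook h (clo bs γ i))
  rec-stops   : ∀ {k n η γ hit} (bs : Fin (suc k) → Expr (suc k + n)) → HitStops γ hit →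
                ∀ u V → HitStops (rec bs γ) ([ enter bs η hit u V , hit ] ∘ splitAt (suc k))

  walk-stops (var x)           c = c x
  walk-stops (letrec {k} bs t) c = walk-stops t (rec-stops bs c (suc k) _)
  walk-stops (app s t)         c = inj₂ (0 , _ , refl)
  walk-stops (lam s)           c = inj₂ (0 , _ , refl)
  walk-stops (con T c′ ss)     c = inj₂ (0 , _ , refl)
  walk-stops (seq s t)         c = inj₂ (0 , _ , refl)
  walk-stops (case T s as)     c = inj₂ (0 , _ , refl)

  enter-stops bs c zero V i = inj₁ refl
  enter-stops bs c (suc u) V i with lookup V i
  ... | true  = inj₁ refl
  ... | false with walk-stops (bs i) (rec-stops bs c u (V [ i ]≔ true))
  ...   | inj₁ b           = inj₁ b
  ...   | inj₂ (h , H , r) = inj₂ (suc h , H , r)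

  rec-stops {k} bs c u V x with splitAt (suc k) x
  ... | inj₁ i = enter-stops bs c u V i
  ... | inj₂ y = c y

  stops₀ : ∀ {n} {η : Env n} {γ} → EnvSim η γ → HitStops γ (hit₀ η)
  stops₀ (free eq) x = inj₂ (0 , _ , refl)
  stops₀ (bound {k} eq e) x with splitAt k x
  ... | inj₁ i = inj₂ (0 , _ , refl)
  ... | inj₂ y = stops₀ e y
  stops₀ (rec {k} {bs = bs} e) = rec-stops bs (stops₀ e) (suc k) _

  -- The part of `labelAt` that comes after the walk, as a function of the outcome, so that
  -- `Match-agree` can treat outcomes with an arbitrary `hit`.
  stopTree : ∀ {κ} → Stop κ → Labelling
  stopTree (ℓ , _ , μs) []      = just ℓ
  stopTree (ℓ , _ , μs) (i ∷ p) =
    maybe′ (λ j → labelAt (μs j) p) nothing (select (rank ℓ) i)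

  labelAt-stop : ∀ {κ} (μ : Marker κ) → labelAt μ ≐ stopTree (stop μ)
  labelAt-stop μ []      = refl
  labelAt-stop μ (i ∷ p) with stop μ
  ... | _ = refl

  Agree-not-bot : ∀ {H st} → Agree H st → proj₁ st ≢ bot
  Agree-not-bot (tree _ eq) b with () ← trans (sym eq) b
  Agree-not-bot (hd _ app _)  ()
  Agree-not-bot (hd _ lam _)  ()
  Agree-not-bot (hd _ con _)  ()
  Agree-not-bot (hd _ seq _)  ()
  Agree-not-bot (hd _ case _) ()

  ∼-unfold    : ∀ d {n} {η : Env n} {γ s} → EnvSim η γ → Sim d γ s (labelAt (expr η s))
  Match-agree : ∀ d {H st} → Agree H st → Match d H (stopTree st)

  ∼-unfold zero e = zero
  ∼-unfold (suc d) {η = η} {γ} {s} e with walk-stops s (stops₀ e)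
  ... | inj₂ (h , H , r) = runs h r
    (Match-resp (λ p → sym (labelAt-stop (expr η s) p))
                (Match-agree d (walk-complete h s e (Complete₀ h e) r)))
  -- If some run stopped, completeness would make it agree with the marked walk, whose label would
  -- then not be Bot.
  ... | inj₁ b = bot stuck (cong just b)
    where
    stuck : ∀ h → run h γ s ≡ nothing
    stuck h with run h γ s in r
    ... | nothing = refl
    ... | just H  = ⊥-elim (Agree-not-bot (walk-complete h s e (Complete₀ h e) r) b)

  Match-agree d (tree {S} {x} {_ , _ , _} eq refl) =
    tree λ p → trans (leaf p) (sym (eq p))
    where
    leaf : ∀ p → _
    leaf []      = refl
    leaf (i ∷ p) = refl
  Match-agree d (hd hit app e)  = app refl (∼-unfold d e) (∼-unfold d e)
  Match-agree d (hd hit lam e)  = lam refl (∼-unfold d (EnvSim-under 1 e))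
  Match-agree d (hd {η = η} hit (con {T} {c} {ss}) e)  =
    con refl λ j → Sim-resp (child j) (∼-unfold d e)
    where
    child : ∀ (j : Fin (ar T c)) → labelAt (expr η (ss j)) ≐
            stopTree (walk η hit (con T c ss)) / toℕ j
    child j p rewrite select-toℕ j = refl
  Match-agree d (hd hit seq e)  = seq refl (∼-unfold d e) (∼-unfold d e)
  Match-agree d (hd {η = η} hit (case {T} {s} {as}) e) =
    case refl (∼-unfold d e) (λ c → sym (child c []))
         λ c → Sim-resp (λ p → child c (0 ∷ p)) (∼-unfold d (EnvSim-under (ar T c) e))
    where
    child : ∀ (c : Fin ∣ T ∣) → labelAt (alt T c η (as c)) ≐
            stopTree (walk η hit (case T s as)) / suc (toℕ c)
    child c p rewrite select-toℕ c = refl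

  ∼-IT : ∀ {n} (s : Expr n) → base (varᵗ ∘ toℕ) ⊢ s ∼ label (IT s)
  ∼-IT s d = ∼-unfold d (free (λ _ _ → refl))

  -- From tree reduction to name reduction

  -- Reduction contexts listed from the hole outwards.
  data Stack (n : ℕ) : Set where
    []   : Stack n
    app  : Stack n → Expr n → Stack n
    seq  : Stack n → Expr n → Stack n
    case : (T : Type) → Stack n → ((c : Fin ∣ T ∣) → Expr (ar T c + n)) → Stack n

  data TreeStack : Set where
    []   : TreeStack
    app  : TreeStack → InfExpr → TreeStack
    seq  : TreeStack → InfExpr → TreeStack
    case : (T : Type) → TreeStack → (Fin ∣ T ∣ → InfExpr) → TreeStack

  data LStack (n : ℕ) : ℕ → Set where
    []  : LStack n n
    _▷_ : ∀ {k m} → LStack n m → (Fin (suc k) → Expr (suc k + m)) → LStack n (suc k + m)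

  infix 30 _S[_] _Z[_] _P[_]

  _S[_] : ∀ {n} → Stack n → Expr n → Expr n
  []          S[ s ] = s
  app K t     S[ s ] = K S[ app s t ]
  seq K t     S[ s ] = K S[ seq s t ]
  case T K as S[ s ] = K S[ case T s as ]

  _Z[_] : TreeStack → InfExpr → InfExpr
  []          Z[ S ] = S
  app Z T     Z[ S ] = Z Z[ appᵗ S T ]
  seq Z T     Z[ S ] = Z Z[ seqᵗ S T ]
  case T Z Ss Z[ S ] = Z Z[ caseᵗ T S Ss ]

  _P[_] : ∀ {n m} → LStack n m → Expr m → Expr n
  []       P[ s ] = s
  (L ▷ bs) P[ s ] = L P[ letrec bs s ]

  envP : ∀ {n m} → GEnv n → LStack n m → GEnv m
  envP γ []       = γ
  envP γ (L ▷ bs) = rec bs (envP γ L)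

  reverseS : ∀ {n} → Stack n → ACtx n → ACtx n
  reverseS []            A = A
  reverseS (app K t)     A = reverseS K (app A t)
  reverseS (seq K t)     A = reverseS K (seq A t)
  reverseS (case T K as) A = reverseS K (case T A as)

  reverseS-[] : ∀ {n} K A (s : Expr n) → reverseS K A A[ s ] ≡ K S[ A A[ s ] ]
  reverseS-[] []            A s = refl
  reverseS-[] (app K t)     A s = reverseS-[] K (app A t) s
  reverseS-[] (seq K t)     A s = reverseS-[] K (seq A t) s
  reverseS-[] (case T K as) A s = reverseS-[] K (case T A as) s

  reverseP : ∀ {n m p} → LStack n m → LCtx m p → LCtx n p
  reverseP []       C = C
  reverseP (L ▷ bs) C = reverseP L (letrec bs C)

  reverseP-[] : ∀ {n m p} (L : LStack n m) (C : LCtx m p) s →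
                reverseP L C L[ s ] ≡ L P[ C L[ s ] ]
  reverseP-[] []       C s = refl
  reverseP-[] (L ▷ bs) C s = reverseP-[] L (letrec bs C) s

  step-in : ∀ {n m} (L : LStack n m) K {e e′} →
            (∀ (R : RCtx n m) → R R[ e ] ⟶name R R[ e′ ]) →
            L P[ K S[ e ] ] ⟶name L P[ K S[ e′ ] ]
  step-in L K {e} {e′} red = ≡.subst₂ _⟶name_ (plug e) (plug e′) (red R)
    where
    R = reverseP L □ , reverseS K □
    plug : ∀ e → R R[ e ] ≡ L P[ K S[ e ] ]
    plug e = trans (reverseP-[] L □ _) (cong (L P[_]) (reverseS-[] K □ e))

  weakenS : ∀ k {n} → Stack n → Stack (k + n)
  weakenS k []            = []
  weakenS k (app K t)     = app (weakenS k K) (weaken k t)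
  weakenS k (seq K t)     = seq (weakenS k K) (weaken k t)
  weakenS k (case T K as) =
    case T (weakenS k K) (λ c → rename (liftRen (ar T c) (k ↑ʳ_)) (as c))

  -- One step per frame. With frames listed from the hole, a crossed frame joins the body of the
  -- letrec and a shorter stack remains.
  float-letrec : ∀ {n m k} (L : LStack n m) K {bs : Fin (suc k) → Expr (suc k + m)} {t} →
                 L P[ K S[ letrec bs t ] ] ⟶name* (L ▷ bs) P[ weakenS (suc k) K S[ t ] ]
  float-letrec L []            = ε
  float-letrec L (app K u)     = step-in L K (λ R → lapp R) ◅ float-letrec L K
  float-letrec L (seq K u)     = step-in L K (λ R → lseq R) ◅ float-letrec L K
  float-letrec L (case T K as) = step-in L K (λ R → lcase R) ◅ float-letrec L K

  data StackSim {n} (γ : GEnv n) : Stack n → TreeStack → Set where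
    []   : StackSim γ [] []
    app  : ∀ {K Z t T} → StackSim γ K Z → γ ⊢ t ∼ label T → StackSim γ (app K t) (app Z T)
    seq  : ∀ {K Z t T} → StackSim γ K Z → γ ⊢ t ∼ label T → StackSim γ (seq K t) (seq Z T)
    case : ∀ {T K Z as Ss} → StackSim γ K Z →
           (∀ c → underᵍ (ar T c) γ ⊢ as c ∼ label (Ss c)) →
           StackSim γ (case T K as) (case T Z Ss)

  StackSim-weaken : ∀ {n k} {γ : GEnv n} (bs : Fin (suc k) → Expr (suc k + n)) {K Z} →
                    StackSim γ K Z → StackSim (rec bs γ) (weakenS (suc k) K) Z
  StackSim-weaken bs []        = []
  StackSim-weaken bs (app k m) =
    app (StackSim-weaken bs k) (λ d → Sim-ren d _ (Ren-weaken-rec bs) (m d))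
  StackSim-weaken bs (seq k m) =
    seq (StackSim-weaken bs k) (λ d → Sim-ren d _ (Ren-weaken-rec bs) (m d))
  StackSim-weaken bs (case {T} k ms) = case (StackSim-weaken bs k)
    (λ c d → Sim-ren d _ (Ren-under (ar T c) _ (Ren-weaken-rec bs)) (ms c d))

  ∼-plugS : ∀ {n} {γ : GEnv n} {K Z e} S → StackSim γ K Z → γ ⊢ e ∼ label S →
            γ ⊢ K S[ e ] ∼ label (Z Z[ S ])
  ∼-plugS S []                      m = m
  ∼-plugS S (app {T = T} k n)       m = ∼-plugS (appᵗ S T) k (∼-app {S = S} {T} m n)
  ∼-plugS S (seq {T = T} k n)       m = ∼-plugS (seqᵗ S T) k (∼-seq {S = S} {T} m n)
  ∼-plugS S (case {T} {Ss = Ss} k ns) m =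
    ∼-plugS (caseᵗ T S Ss) k (∼-case {S = S} {Ss} m ns)

  ∼-plugP : ∀ {n m} {γ : GEnv n} (L : LStack n m) {e S} → envP γ L ⊢ e ∼ S → γ ⊢ L P[ e ] ∼ S
  ∼-plugP []       m = m
  ∼-plugP (L ▷ bs) m = ∼-plugP L (λ d → Sim-letrec (m d))

  top : ∀ n → GEnv n
  top n = base (varᵗ ∘ toℕ)

  -- Reduction contexts bind by letrec only, so a variable standing for a tree is free in the whole
  -- expression. Hence a walk towards an inner node cannot end at such a variable.
  look-tree : ∀ {n m} (L : LStack n m) x {S} → look (envP (top n) L) x ≡ tree S →
              ∃ λ y → label S [] ≡ just (var y)
  look-tree [] x refl = toℕ x , refl
  look-tree (_▷_ {k} L bs) x eq with splitAt (suc k) x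
  ... | inj₂ y = look-tree L y eq

  -- Searches outwards for the group that binds `x`. The groups passed on the way move into `C`,
  -- which becomes the context that `gcp` requires between group and occurrence.
  copy-in : ∀ {n m p k l} (L : LStack n m) (C : LCtx m p) A x
            {bs : Fin (suc k) → Expr (suc k + l)} {γ i} → look (envP (top n) L) x ≡ clo bs γ i →
            ∃ λ ρ → (L P[ C L[ A A[ var (inL C x) ] ] ] ⟶name L P[ C L[ A A[ rename ρ (bs i) ] ] ])
                  × Ren ρ (rec bs γ) (envL (envP (top n) L) C)
  copy-in {n} (_▷_ {k} {m} L bs) C A x eq with splitAt (suc k) x in x≡
  copy-in {n} (_▷_ {k} {m} L bs) C A x refl | inj₁ i with refl ← splitAt⁻¹-↑ˡ {suc k} {m} {x} x≡ =
    inL C ,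
    ≡.subst₂ _⟶name_ (reverseP-[] L □ _) (reverseP-[] L □ _) (gcp (reverseP L □) bs C A i) ,
    ren λ y → ≡.subst (RenLook (look γ y)) (sym (look-inL γ C y)) same
    where γ = rec bs (envP (top n) L)
  copy-in (_▷_ {k} {m} L bs) C A x eq | inj₂ y with refl ← splitAt⁻¹-↑ʳ {suc k} {m} {x} x≡ =
    copy-in L (letrec bs C) A y eq

  copy : ∀ {n m k l} (L : LStack n m) K x
         {bs : Fin (suc k) → Expr (suc k + l)} {γ i} → look (envP (top n) L) x ≡ clo bs γ i →
         ∃ λ ρ → (L P[ K S[ var x ] ] ⟶name L P[ K S[ rename ρ (bs i) ] ])
               × Ren ρ (rec bs γ) (envP (top n) L)
  copy L K x {bs} {i = i} eq with copy-in L □ (reverseS K □) x eq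
  ... | ρ , red , r = ρ ,
    ≡.subst₂ _⟶name_ (cong (L P[_]) (reverseS-[] K □ _)) (cong (L P[_]) (reverseS-[] K □ _)) red , r

  -- `Z` and `S` stay fixed while the expression is reduced, because the steps that expose a node do
  -- not change the tree.
  record Exposed {n} (s : Expr n) (Z : TreeStack) (S : InfExpr) (ℓ : Label) : Set where
    constructor exposed
    field
      {scope}   : ℕ
      bindings  : LStack n scope
      stack     : Stack scope
      head      : Expr scope
      reduces   : s ⟶name* bindings P[ stack S[ head ] ]
      headOf    : HeadOf ℓ head
      stackSim  : StackSim (envP (top n) bindings) stack Z
      headMatch : ∀ d → Match d (hd (envP (top n) bindings) head) (label S)

  _then_ : ∀ {n} {s t : Expr n} {Z S ℓ} → s ⟶name* t → Exposed t Z S ℓ → Exposed s Z S ℓ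
  reds then exposed L K w reds′ h k m = exposed L K w (reds ◅◅ reds′) h k m

  just-head : ∀ {H m} → Pointwise RenHead (just H) m → ∃ λ H′ → m ≡ just H′
  just-head (just {y = H′} _) = H′ , refl

  -- Recursion on the fuel, then on `e`. A copied binding is not a subterm of `e`, but by `run-ren`
  -- its walk stops with the fuel left after the hit.
  expose-run : ∀ h {n m} (L : LStack n m) K e {Z H ℓ} S → NonVar ℓ → label S [] ≡ just ℓ →
               StackSim (envP (top n) L) K Z → envP (top n) L ⊢ e ∼ label S →
               run h (envP (top n) L) e ≡ just H → Exposed (L P[ K S[ e ] ]) Z S ℓ
  expose-run h {n} L K (var x) S nv root k m r with look (envP (top n) L) x in eq
  expose-run h L K (var x) S nv root k m refl | tree T
    with ∼-match {h = 0} m (cong (runLook 0) eq) 0 | look-tree L x eq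
  ... | tree S≐T | y , T≡ with trans (sym root) (trans (S≐T []) T≡)
  ...   | refl = ⊥-elim nv
  expose-run (suc h) {n} L K (var x) S nv root k m r | clo bs γ i with copy L K x eq
  ... | ρ , red , ρ-ren
    with just-head (≡.subst (λ r → Pointwise RenHead r _) r (run-ren h ρ (bs i) ρ-ren))
  ...   | H′ , r′ = (red ◅ ε) then
    expose-run h L K (rename ρ (bs i)) S nv root k
      (λ d → Sim-ren d ρ ρ-ren (Sim-leave eq (m d))) r′
  expose-run h L K (letrec bs t) S nv root k m r = float-letrec L K then
    expose-run h (L ▷ bs) _ t S nv root (StackSim-weaken bs k) (λ d → Sim-unletrec (m d)) r
  expose-run h L K (app s t) S nv root k m r with ∼-match {h = 0} m refl
  ... | M with trans (sym root) (proj₁ (Match-app {S = label S} M))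
  ...   | refl = exposed L K _ ε app k M
  expose-run h L K (lam s) S nv root k m r with ∼-match {h = 0} m refl
  ... | M with trans (sym root) (proj₁ (Match-lam {S = label S} M))
  ...   | refl = exposed L K _ ε lam k M
  expose-run h L K (con T c ss) S nv root k m r with ∼-match {h = 0} m refl
  ... | M with trans (sym root) (proj₁ (Match-con {S = label S} M))
  ...   | refl = exposed L K _ ε con k M
  expose-run h L K (seq s t) S nv root k m r with ∼-match {h = 0} m refl
  ... | M with trans (sym root) (proj₁ (Match-seq {S = label S} M))
  ...   | refl = exposed L K _ ε seq k M
  expose-run h L K (case T s as) S nv root k m r with ∼-match {h = 0} m refl
  ... | M with trans (sym root) (proj₁ (Match-case {S = label S} M))
  ...   | refl = exposed L K _ ε case k M

  expose : ∀ {n m} (L : LStack n m) K e {Z ℓ} S → NonVar ℓ → ℓ ≢ bot → label S [] ≡ just ℓ →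
           StackSim (envP (top n) L) K Z → envP (top n) L ⊢ e ∼ label S →
           Exposed (L P[ K S[ e ] ]) Z S ℓ
  expose L K e S nv ℓ≢bot root k m with m 1
  ... | runs h r _ = expose-run h L K e S nv root k m r
  ... | bot _ b    = ⊥-elim (ℓ≢bot (just-injective (trans (sym root) b)))

  -- Name reductions that realise a tree step

  record Backward {n} (s : Expr n) (S : InfExpr) : Set where
    constructor reached
    field
      {reduct}  : Expr n
      reduction : s ⟶name* reduct
      simulates : top n ⊢ reduct ∼ label S

  _then′_ : ∀ {n} {s t : Expr n} {S} → s ⟶name* t → Backward t S → Backward s S
  reds then′ reached reds′ m = reached (reds ◅◅ reds′) m

  backward-step : ∀ {n m} (L : LStack n m) K {e e′ Z} S →
                  (∀ (R : RCtx n m) → R R[ e ] ⟶name R R[ e′ ]) →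
                  StackSim (envP (top n) L) K Z → envP (top n) L ⊢ e′ ∼ label S →
                  Backward (L P[ K S[ e ] ]) (Z Z[ S ])
  backward-step L K {e′ = e′} S red k m =
    reached (step-in L K red ◅ ε) (∼-plugP L (∼-plugS S k m))

  -- Recursion on the tree context: each of its nodes is exposed in the expression and pushed on the
  -- stack, until the nodes of the redex itself are reached.
  backward : ∀ {n m} (L : LStack n m) K {e Z} R {S S′} → S ↦ S′ →
             StackSim (envP (top n) L) K Z → envP (top n) L ⊢ e ∼ label (R T[ S ]) →
             Backward (L P[ K S[ e ] ]) (Z Z[ R T[ S′ ] ])
  backward L K {e} (app R T) {S} red k m
    with expose L K e (appᵗ (R T[ S ]) T) tt (λ ()) refl k m
  ... | exposed L′ K′ _ reds app k′ M with Match-app M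
  ...   | _ , m₁ , m₂ = reds then′ backward L′ (app K′ _) R red (app k′ m₂) m₁
  backward L K {e} (seq R T) {S} red k m
    with expose L K e (seqᵗ (R T[ S ]) T) tt (λ ()) refl k m
  ... | exposed L′ K′ _ reds seq k′ M with Match-seq M
  ...   | _ , m₁ , m₂ = reds then′ backward L′ (seq K′ _) R red (seq k′ m₂) m₁
  backward L K {e} (case T R Ss) {S} red k m
    with expose L K e (caseᵗ T (R T[ S ]) Ss) tt (λ ()) refl k m
  ... | exposed L′ K′ _ reds case k′ M with Match-case M
  ...   | _ , m₁ , ms = reds then′ backward L′ (case T K′ _) R red
    (case k′ λ c → ∼-resp (caseᵗ-alt T (R T[ S ]) Ss c) (proj₂ (ms c))) m₁
  backward L K {e} □ (beta {S₁} {S₂}) k m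
    with expose L K e (appᵗ (lamᵗ S₁) S₂) tt (λ ()) refl k m
  ... | exposed L₁ K₁ _ reds₁ (app {s}) k₁ M₁ with Match-app M₁
  -- The function may still be a variable or hidden below letrecs. Exposing it with the application
  -- on the stack puts the abstraction directly under that application.
  ...   | _ , m₁ , m₂ with expose L₁ (app K₁ _) s (lamᵗ S₁) tt (λ ()) refl (app {T = S₂} k₁ m₂) m₁
  ...     | exposed L₂ (app K₂ _) _ reds₂ (lam {b}) (app k₂ n₂) M₂ with Match-lam M₂
  ...       | _ , n₁ = (reds₁ ◅◅ reds₂) then′
    backward-step L₂ K₂ (S₁ ⟨ 1 ∣ const S₂ ⟩ᵗ) (λ R → beta R) k₂
      (∼-inst {s = b} {S₁} n₁ (λ _ → n₂))
  backward L K {e} □ (seq {S₁} {S₂} ans) k m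
    with expose L K e (seqᵗ S₁ S₂) tt (λ ()) refl k m
  ... | exposed L₁ K₁ _ reds₁ (seq {s}) k₁ M₁ with Match-seq M₁
  backward L K □ (seq {S₁} {S₂} (lam η)) k m
      | exposed L₁ K₁ _ reds₁ (seq {s}) k₁ M₁ | _ , m₁ , m₂
    with expose L₁ (seq K₁ _) s S₁ tt (λ ()) (η []) (seq {T = S₂} k₁ m₂) m₁
  ... | exposed L₂ (seq K₂ _) _ reds₂ lam (seq k₂ n₂) _ = (reds₁ ◅◅ reds₂) then′
    backward-step L₂ K₂ S₂ (λ R → seq R lam) k₂ n₂
  backward L K □ (seq {S₁} {S₂} (con η)) k m
      | exposed L₁ K₁ _ reds₁ (seq {s}) k₁ M₁ | _ , m₁ , m₂
    with expose L₁ (seq K₁ _) s S₁ tt (λ ()) (η []) (seq {T = S₂} k₁ m₂) m₁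
  ... | exposed L₂ (seq K₂ _) _ reds₂ con (seq k₂ n₂) _ = (reds₁ ◅◅ reds₂) then′
    backward-step L₂ K₂ S₂ (λ R → seq R con) k₂ n₂
  backward L K {e} □ (case {T} {c} {Ts} {Ss}) k m
    with expose L K e (caseᵗ T (conᵗ T c Ts) Ss) tt (λ ()) refl k m
  ... | exposed L₁ K₁ _ reds₁ (case {s = s}) k₁ M₁ with Match-case M₁
  ...   | _ , m₁ , ms
    with expose L₁ (case T K₁ _) s (conᵗ T c Ts) tt (λ ()) refl
           (case {Ss = Ss} k₁ λ c′ → ∼-resp (caseᵗ-alt T (conᵗ T c Ts) Ss c′) (proj₂ (ms c′))) m₁
  ...     | exposed L₂ (case _ K₂ as) _ reds₂ con (case k₂ ns) M₂ with Match-con M₂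
  ...       | _ , ms₂ = (reds₁ ◅◅ reds₂) then′
    backward-step L₂ K₂ (Ss c ⟨ ar T c ∣ Ts ⟩ᵗ) (λ R → case R) k₂
      (∼-inst {s = as c} {Ss c} (ns c) λ j → ∼-resp (conᵗ-arg T c Ts j) (ms₂ j))

  -- A stack related to the empty tree stack is empty, so only letrecs surround the exposed value.
  expose-whnf : ∀ {n} {s : Expr n} {S ℓ} → (∀ {m w} → HeadOf {m} ℓ w → Value w) →
                Exposed s [] S ℓ → s ↓name
  expose-whnf value (exposed L [] w reds h [] _) =
    L P[ w ] , reds , ≡.subst WHNF (reverseP-[] L □ w) (whnf (reverseP L □) (value h))

  tree⇒name : ∀ {n} (s : Expr n) S {S′} → top n ⊢ s ∼ label S →
              S ⟶tree* S′ → Answer S′ → s ↓name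
  tree⇒name s S m (_◅_ {j = S₁} (step R eq red eq′) reds) ans
    with backward [] [] {s} R red [] (∼-resp eq m)
  ... | reached {s′} nreds m′
    with tree⇒name s′ S₁ (∼-resp (λ p → sym (eq′ p)) m′) reds ans
  ... | w , nreds′ , v = w , nreds ◅◅ nreds′ , v
  tree⇒name s S m ε (lam η) =
    expose-whnf (λ { lam → lam }) (expose [] [] s S tt (λ ()) (η []) [] m)
  tree⇒name s S m ε (con η) =
    expose-whnf (λ { con → con }) (expose [] [] s S tt (λ ()) (η []) [] m)

corollary5p30 : (𝒮 : Signature) → let open Calculus 𝒮 in
    (n : ℕ) (s : Expr n) → (s ↓name) ⇔ (IT s ↓tree)
corollary5p30 𝒮 n s = mk⇔
  (name⇒tree (IT s) (∼-IT s))
  (λ { (_ , reds , answer) → tree⇒name s (IT s) (∼-IT s) reds answer })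
  where
  open Calculus 𝒮
  open Adequacy 𝒮
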